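{- Let $n$ be a positive integer, let $\mathcal B\subseteq\mathcal P([n])$ be a simply rooted family with $|\mathcal B|=m$, and let $p\in[0,1]$. Suppose that no $i\in[n]$ has $|\mathcal B_{\{i\}}|\ge pm$. Then \[ \|\mathcal B\|\le \|\mathcal I(m)\|+m-\frac{m^2(1/8-p^2/8)}{2^n}. \]
   Context: A family $\mathcal B\subseteq\mathcal P([n])$ is simply rooted if for every nonempty $B\in\mathcal B$ there is $b\in B$ with $[\{b\},B]:=\{C:\{b\}\subseteq C\subseteq B\}\subseteq\mathcal B$. $B\in\mathcal B$ is $\mathcal B$-rooted at $i$ if $i\in B$ and $[\{i\},B]\subseteq\mathcal B$; for $S\subseteq[n]$, $\mathcal B_S$ is the family of sets of $\mathcal B$ that are $\mathcal B$-rooted at some $i\in S$. $\|\mathcal F\|=\sum_{F\in\mathcal F}|F|$. The colex order on finite sets of positive integers: $A<B$ iff $\max(A\triangle B)\in B$; $\mathcal I(m)$ is the family of the first $m$ sets in this order.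
   Formalization: The parameter p is taken to be a rational number in [0,1] rather than a real one; the real case follows by choosing a rational q ≤ p with every |B_{i}| < qm, since the bound increases with p. -}

module Defs where

open import Data.Nat using (ℕ; zero; suc; _+_; _<_; _≤_)
open import Data.Bool using (Bool)
import Data.Bool as Bool
open import Data.Fin using (Fin)
open import Data.Fin.Subset using (Subset; _∈_; _∉_; _⊆_; Nonempty; ∣_∣)
open import Data.Fin.Subset.Properties using (_∈?_; _⊆?_; anySubset?)
open import Data.Vec.Properties using (≡-dec)
open import Data.List using (List; []; _∷_; filter; length; map)
open import Data.Nat.ListAction using (sum)
import Data.List.Membership.DecPropositional as DecMem
open import Data.List.Membership.Propositional using () renaming (_∈_ to _∈ℓ_; _∉_ to _∉ℓ_)
open import Data.List.Relation.Unary.Linked using (Linked)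
open import Data.List.Relation.Unary.All using (All)
open import Data.List.Relation.Unary.Unique.Propositional using (Unique)
open import Data.Product using (Σ; ∃; _×_; _,_; proj₁; proj₂)
open import Data.Sum using (_⊎_)
open import Relation.Nullary using (Dec; yes; no; ¬_)
open import Relation.Nullary.Decidable using (_×-dec_)
open import Relation.Nullary.Negation using (contradiction)
open import Relation.Binary.PropositionalEquality using (_≡_)

-- A family ℬ ⊆ 𝒫([n]) is represented by a duplicate-free list of subsets
-- (uniqueness is imposed in the theorem statement).
Family : ℕ → Set
Family n = List (Subset n)

_∈ℬ?_ : ∀ {n} (C : Subset n) (ℬ : Family n) → Dec (C ∈ℓ ℬ)
_∈ℬ?_ {n} = DecMem._∈?_ (≡-dec Bool._≟_)

RootedAt : ∀ {n} → Family n → Fin n → Subset n → Set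
RootedAt {n} ℬ i B = i ∈ B × (∀ (C : Subset n) → i ∈ C → C ⊆ B → C ∈ℓ ℬ)

SimplyRooted : ∀ {n} → Family n → Set
SimplyRooted {n} ℬ = ∀ (B : Subset n) → B ∈ℓ ℬ → Nonempty B → ∃ λ b → RootedAt ℬ b B

private
  Bad : ∀ {n} → Family n → Fin n → Subset n → Subset n → Set
  Bad ℬ i B C = i ∈ C × (C ⊆ B × C ∉ℓ ℬ)

  bad? : ∀ {n} (ℬ : Family n) i B C → Dec (Bad ℬ i B C)
  bad? ℬ i B C with i ∈? C | C ⊆? B | C ∈ℬ? ℬ
  ... | yes a | yes b | no c = yes (a , b , c)
  ... | no a  | _     | _    = no (λ x → a (proj₁ x))
  ... | yes _ | no b  | _    = no (λ x → b (proj₁ (proj₂ x)))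
  ... | yes _ | yes _ | yes c = no (λ x → proj₂ (proj₂ x) c)

rootedAt? : ∀ {n} (ℬ : Family n) (i : Fin n) (B : Subset n) → Dec (RootedAt ℬ i B)
rootedAt? ℬ i B with i ∈? B | anySubset? (bad? ℬ i B)
... | no a  | _ = no (λ x → a (proj₁ x))
... | yes a | yes (C , c , d , e) = no (λ x → e (proj₂ x C c d))
... | yes a | no nb = yes (a , λ C c d → helper C c d)
  where
  helper : ∀ C → _ → C ⊆ B → C ∈ℓ ℬ
  helper C c d with C ∈ℬ? ℬ
  ... | yes e = e
  ... | no e = contradiction (C , c , (λ {x} → d {x}) , e) nb

rootedFamily : ∀ {n} → Family n → Fin n → Family n
rootedFamily ℬ i = filter (rootedAt? ℬ i) ℬ

weight : ∀ {n} → Family n → ℕ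
weight ℬ = sum (map ∣_∣ ℬ)

-- a finite set of positive integers is represented by its strictly
-- increasing list of elements (canonical representation)
IsPosSet : List ℕ → Set
IsPosSet xs = Linked _<_ xs × All (1 ≤_) xs

-- A <colex B  iff  max(A △ B) ∈ B  (so in particular A △ B ≠ ∅):
-- there is x ∈ B with x ∉ A such that A and B agree above x.
_<colex_ : List ℕ → List ℕ → Set
A <colex B = ∃ λ x → x ∈ℓ B × x ∉ℓ A ×
  (∀ y → x < y → (y ∈ℓ A → y ∈ℓ B) × (y ∈ℓ B → y ∈ℓ A))

IsColexInitial : ℕ → List (List ℕ) → Set
IsColexInitial m 𝓘 = Unique 𝓘 × length 𝓘 ≡ m × All IsPosSet 𝓘 ×
  (∀ A → A ∈ℓ 𝓘 → ∀ B → IsPosSet B → B <colex A → B ∈ℓ 𝓘)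

weightℕ : List (List ℕ) → ℕ
weightℕ 𝓘 = sum (map length 𝓘)

{-# OPTIONS --safe #-}

-- The sets that are rooted at no element form a union-closed family N, and its
-- complement is ℬ without ∅.  Up-compressing N one coordinate at a time, as in
-- Reimer's proof of the average set size theorem, gives ‖ℬ‖ ≤ ‖𝓘(m)‖ + m, and
-- every set outside N that is not consumed by the compression is a gain.
-- For a threshold k let P and Q be the families of sets that are not rooted below
-- k, respectively not rooted from k on, so that N = P ⊓ Q.  Compressing first the
-- coordinates below k and then the others, Kleitman's correlation inequality
-- bounds the gain below by a c / 2ⁿ, where a and c count the sets rooted below k
-- and from k on.  As k grows, a increases in steps smaller than p m, so |m - 2a| is
-- smaller than p m for some k, and then 4 a (m - a) exceeds m² (1 - p²).

module Submission where

open import Defs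

-- Kleitman's inequality needs up-sets, but P is closed upwards only in the coordinates from k on,
-- and Q only in those below k. This forces the order of compression: once the coordinates below k
-- are done, P is an up-set in every fibre over them and N is closed upwards relative to Q. The
-- latter does not come from union-closedness of N; it is extracted from rootedness itself, as
-- `Fillable`.
--
-- The gain a c / 2ⁿ is a difference of two counts of lifted sets. The compressions below k lift at
-- most |Q ⊓ ∁ N| sets, the others at most |P| |∁ Q| / 2ⁿ. As |Q ⊓ ∁ N| + |∁ Q| = |∁ N|, the
-- allowance |∁ N| is undercut by |∁ Q| (1 - |P| / 2ⁿ) = a c / 2ⁿ.
--
-- The empty set has no root, so |∁ N| may be m - 1. The deficit e costs a e in the estimate of a c,
-- but leaves a surplus e in the summand m, which is worth 2ⁿ e ≥ a e on the scale of that product.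

-- Sums of binary digits and their superadditivity.

module BinaryDigitSums where
  open import Data.Bool using (Bool; true; false)
  open import Data.List using (List; []; _∷_)
  open import Data.Nat
  open import Data.Nat.Properties
  open import Data.Nat.Tactic.RingSolver using (solve-∀)
  open import Data.Product using (∃; _,_)
  open import Data.Sum using (_⊎_; inj₁; inj₂)
  open import Relation.Binary.PropositionalEquality

  ⟦_⟧ : Bool → ℕ
  ⟦ true ⟧ = 1
  ⟦ false ⟧ = 0

  increment : List Bool → List Bool
  increment [] = true ∷ []
  increment (false ∷ bs) = true ∷ bs
  increment (true ∷ bs) = false ∷ increment bs

  binary : ℕ → List Bool
  binary zero = []
  binary (suc n) = increment (binary n)

  ones : List Bool → ℕ
  ones [] = 0
  ones (b ∷ bs) = ⟦ b ⟧ + ones bs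

  -- g m = ‖𝓘(m)‖: counting from 0, the m-th set in colex order is the binary expansion of m.
  g : ℕ → ℕ
  g zero = 0
  g (suc n) = g n + ones (binary n)

  binary-odd : ∀ k → binary (suc (k + k)) ≡ true ∷ binary k
  binary-odd zero = refl
  binary-odd (suc k) rewrite +-suc k k | binary-odd k = refl

  ones-even : ∀ k → ones (binary (k + k)) ≡ ones (binary k)
  ones-even zero = refl
  ones-even (suc k) rewrite +-suc k k | binary-odd k = refl

  -- Split the numbers below 2k by their lowest digit: the even and the odd ones both run through
  -- the numbers below k in the higher digits, and the odd ones contribute k further ones.
  g-even : ∀ k → g (k + k) ≡ g k + g k + k
  g-even zero = refl
  g-even (suc k) rewrite +-suc k k | binary-odd k | g-even k | ones-even k =
    rearrange (g k) k (ones (binary k))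
    where
    rearrange : ∀ a k o → a + a + k + o + (1 + o) ≡ a + o + (a + o) + suc k
    rearrange = solve-∀

  g-odd : ∀ k → g (suc (k + k)) ≡ g k + g (suc k) + k
  g-odd k rewrite g-even k | ones-even k = rearrange (g k) k (ones (binary k))
    where
    rearrange : ∀ a k o → a + a + k + o ≡ a + (a + o) + k
    rearrange = solve-∀

  even⊎odd : ∀ n → ∃ λ k → n ≡ k + k ⊎ n ≡ suc (k + k)
  even⊎odd zero = 0 , inj₁ refl
  even⊎odd (suc n) with even⊎odd n
  ... | k , inj₁ p = k , inj₂ (cong suc p)
  ... | k , inj₂ p = suc k , inj₁ (cong suc (trans p (sym (+-suc k k))))

  half-≤ : ∀ {x y} → y + y ≤ suc (x + x) → y ≤ x
  half-≤ {x} {y} h = ≮⇒≥ λ x<y → <-irrefl refl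
    (≤-trans (s≤s h) (≤-trans (≤-reflexive (cong suc (sym (+-suc x x)))) (+-mono-≤ x<y x<y)))

  half-< : ∀ {x y} → suc (y + y) ≤ x + x → y < x
  half-< {x} {y} h = half-≤ (s≤s (≤-trans (≤-reflexive (+-suc y y)) h))

  digit-≤ : ∀ {u v} a b → ⟦ a ⟧ + (u + u) ≤ ⟦ b ⟧ + (v + v) → u ≤ v
  digit-≤ a true h = half-≤ (≤-trans (m≤n+m _ ⟦ a ⟧) h)
  digit-≤ a false h = half-≤ (m≤n⇒m≤1+n (≤-trans (m≤n+m _ ⟦ a ⟧) h))

  digit-injective : ∀ {u v} a b → u ≡ v → ⟦ a ⟧ + (u + u) ≡ ⟦ b ⟧ + (v + v) → a ≡ b
  digit-injective true true _ _ = refl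
  digit-injective false false _ _ = refl
  digit-injective true false refl eq with () ← 1+n≢n eq
  digit-injective false true refl eq with () ← 1+n≢n (sym eq)

  summand-≤ : ∀ {n s u} v → s ≡ u + v → 1 ≤ v → s ≤ suc n → u ≤ n
  summand-≤ {n} {s} {u} v eq 1≤v h =
    s≤s⁻¹ (≤-trans (≤-reflexive (+-comm 1 u)) (≤-trans (+-monoʳ-≤ u 1≤v) (≤-trans (≤-reflexive (sym eq)) h)))

  private
    open ≤-Reasoning

    superadditive-even-even : ∀ x y → g x + g y + y ≤ g (x + y) →
      g (x + x) + g (y + y) + (y + y) ≤ g ((x + x) + (y + y))
    superadditive-even-even x y h = begin
      g (x + x) + g (y + y) + (y + y)
        ≡⟨ cong₂ (λ a b → a + b + (y + y)) (g-even x) (g-even y) ⟩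
      (g x + g x + x) + (g y + g y + y) + (y + y)
        ≡⟨ rearrange (g x) (g y) x y ⟩
      (g x + g y + y) + (g x + g y + y) + (x + y)
        ≤⟨ +-monoˡ-≤ (x + y) (+-mono-≤ h h) ⟩
      g (x + y) + g (x + y) + (x + y)
        ≡⟨ g-even (x + y) ⟨
      g ((x + y) + (x + y))
        ≡⟨ cong g (shuffle x y) ⟩
      g ((x + x) + (y + y)) ∎
      where
      rearrange : ∀ a b x y → (a + a + x) + (b + b + y) + (y + y) ≡ (a + b + y) + (a + b + y) + (x + y)
      rearrange = solve-∀
      shuffle : ∀ x y → (x + y) + (x + y) ≡ (x + x) + (y + y)
      shuffle = solve-∀

    superadditive-odd-odd : ∀ x y → g x + g (suc y) + suc y ≤ g (x + suc y) →
      g (suc x) + g y + y ≤ g (suc x + y) →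
      g (suc (x + x)) + g (suc (y + y)) + suc (y + y) ≤ g (suc (x + x) + suc (y + y))
    superadditive-odd-odd x y h h′ = begin
      g (suc (x + x)) + g (suc (y + y)) + suc (y + y)
        ≡⟨ cong₂ (λ a b → a + b + suc (y + y)) (g-odd x) (g-odd y) ⟩
      (g x + g (suc x) + x) + (g y + g (suc y) + y) + suc (y + y)
        ≡⟨ rearrange (g x) (g (suc x)) (g y) (g (suc y)) x y ⟩
      (g x + g (suc y) + suc y) + (g (suc x) + g y + y) + (x + y)
        ≤⟨ +-mono-≤ (+-mono-≤ h h′) (n≤1+n _) ⟩
      g (x + suc y) + g (suc x + y) + suc (x + y)
        ≡⟨ cong (λ z → g z + g (suc x + y) + suc (x + y)) (+-suc x y) ⟩
      g (suc x + y) + g (suc x + y) + suc (x + y)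
        ≡⟨ g-even (suc x + y) ⟨
      g ((suc x + y) + (suc x + y))
        ≡⟨ cong g (shuffle x y) ⟩
      g (suc (x + x) + suc (y + y)) ∎
      where
      rearrange : ∀ a a′ b b′ x y → (a + a′ + x) + (b + b′ + y) + suc (y + y) ≡
                  (a + b′ + suc y) + (a′ + b + y) + (x + y)
      rearrange = solve-∀
      shuffle : ∀ x y → (suc x + y) + (suc x + y) ≡ suc (x + x) + suc (y + y)
      shuffle = solve-∀

    superadditive-odd-even : ∀ x y → g x + g y + y ≤ g (x + y) →
      g (suc x) + g y + y ≤ g (suc x + y) →
      g (suc (x + x)) + g (y + y) + (y + y) ≤ g (suc (x + x) + (y + y))
    superadditive-odd-even x y h h′ = begin
      g (suc (x + x)) + g (y + y) + (y + y)
        ≡⟨ cong₂ (λ a b → a + b + (y + y)) (g-odd x) (g-even y) ⟩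
      (g x + g (suc x) + x) + (g y + g y + y) + (y + y)
        ≡⟨ rearrange (g x) (g (suc x)) (g y) x y ⟩
      (g x + g y + y) + (g (suc x) + g y + y) + (x + y)
        ≤⟨ +-monoˡ-≤ (x + y) (+-mono-≤ h h′) ⟩
      g (x + y) + g (suc (x + y)) + (x + y)
        ≡⟨ g-odd (x + y) ⟨
      g (suc ((x + y) + (x + y)))
        ≡⟨ cong g (shuffle x y) ⟩
      g (suc (x + x) + (y + y)) ∎
      where
      rearrange : ∀ a a′ b x y → (a + a′ + x) + (b + b + y) + (y + y) ≡
                  (a + b + y) + (a′ + b + y) + (x + y)
      rearrange = solve-∀
      shuffle : ∀ x y → suc ((x + y) + (x + y)) ≡ suc (x + x) + (y + y)
      shuffle = solve-∀

    superadditive-even-odd : ∀ x y → g x + g y + y ≤ g (x + y) →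
      g x + g (suc y) + suc y ≤ g (x + suc y) →
      g (x + x) + g (suc (y + y)) + suc (y + y) ≤ g ((x + x) + suc (y + y))
    superadditive-even-odd x y h h′ = begin
      g (x + x) + g (suc (y + y)) + suc (y + y)
        ≡⟨ cong₂ (λ a b → a + b + suc (y + y)) (g-even x) (g-odd y) ⟩
      (g x + g x + x) + (g y + g (suc y) + y) + suc (y + y)
        ≡⟨ rearrange (g x) (g y) (g (suc y)) x y ⟩
      (g x + g y + y) + (g x + g (suc y) + suc y) + (x + y)
        ≤⟨ +-monoˡ-≤ (x + y) (+-mono-≤ h h′) ⟩
      g (x + y) + g (x + suc y) + (x + y)
        ≡⟨ cong (λ z → g (x + y) + g z + (x + y)) (+-suc x y) ⟩
      g (x + y) + g (suc (x + y)) + (x + y)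
        ≡⟨ g-odd (x + y) ⟨
      g (suc ((x + y) + (x + y)))
        ≡⟨ cong g (shuffle x y) ⟩
      g ((x + x) + suc (y + y)) ∎
      where
      rearrange : ∀ a b b′ x y → (a + a + x) + (b + b′ + y) + suc (y + y) ≡
                  (a + b + y) + (a + b′ + suc y) + (x + y)
      rearrange = solve-∀
      shuffle : ∀ x y → suc ((x + y) + (x + y)) ≡ (x + x) + suc (y + y)
      shuffle = solve-∀

  -- The numerical core of edge isoperimetry in the cube. Both numbers are halved, and the halves
  -- are paired so that the sums of the pairs are the two halves of a + b. For odd 2x + 1 and 2y + 1
  -- the pairing is crosswise, x with y + 1 and x + 1 with y, which keeps the required order only if
  -- b < a; the case a = b is `g-even`.
  g-superadditive : ∀ a b → b ≤ a → g a + g b + b ≤ g (a + b)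
  g-superadditive a b = go (a + b) a b ≤-refl
    where
    ee : ∀ x y → (x + x) + (y + y) ≡ (x + y) + (x + y)
    ee = solve-∀
    go : ∀ n a b → a + b ≤ n → b ≤ a → g a + g b + b ≤ g (a + b)
    go n a b h b≤a with m≤n⇒m<n∨m≡n b≤a
    ... | inj₂ refl = ≤-reflexive (sym (g-even a))
    go zero (suc a) b () b≤a | inj₁ b<a
    go (suc n) a b h b≤a | inj₁ b<a with even⊎odd a | even⊎odd b
    ... | _ | zero , inj₁ refl =
      ≤-reflexive (trans (+-identityʳ _) (trans (+-identityʳ (g a)) (cong g (sym (+-identityʳ a)))))
    ... | x , inj₁ refl | suc y , inj₁ refl =
      superadditive-even-even x (suc y)
        (go n x (suc y) (summand-≤ (x + suc y) (ee x (suc y)) (m≤n⇒m≤o+n x (s≤s z≤n)) h)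
          (half-≤ (m≤n⇒m≤1+n b≤a)))
    go (suc n) a b h () | inj₁ b<a | zero , inj₁ refl | zero , inj₂ refl
    go (suc n) a b h b≤a | inj₁ b<a | x , inj₂ refl | suc y , inj₁ refl =
      superadditive-odd-even x (suc y)
        (go n x (suc y) (summand-≤ (suc (x + suc y)) (oe₁ x (suc y)) (s≤s z≤n) h) y≤x)
        (go n (suc x) (suc y) (summand-≤ (x + suc y) (oe₂ x (suc y)) (m≤n⇒m≤o+n x (s≤s z≤n)) h) (m≤n⇒m≤1+n y≤x))
      where
      y≤x = half-≤ {x} {suc y} b≤a
      oe₁ : ∀ x y → suc (x + x) + (y + y) ≡ (x + y) + suc (x + y)
      oe₁ = solve-∀
      oe₂ : ∀ x y → suc (x + x) + (y + y) ≡ (suc x + y) + (x + y)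
      oe₂ = solve-∀
    go (suc n) a b h b≤a | inj₁ b<a | suc x , inj₁ refl | y , inj₂ refl =
      superadditive-even-odd (suc x) y
        (go n (suc x) y (summand-≤ (suc (suc x + y)) (eo₁ (suc x) y) (s≤s z≤n) h) (<⇒≤ y<x))
        (go n (suc x) (suc y) (summand-≤ (suc x + y) (eo₂ (suc x) y) (s≤s z≤n) h) y<x)
      where
      y<x : y < suc x
      y<x = half-< b≤a
      eo₁ : ∀ x y → (x + x) + suc (y + y) ≡ (x + y) + suc (x + y)
      eo₁ = solve-∀
      eo₂ : ∀ x y → (x + x) + suc (y + y) ≡ (x + suc y) + (x + y)
      eo₂ = solve-∀
    go (suc n) a b h b≤a | inj₁ b<a | x , inj₂ refl | y , inj₂ refl =
      superadditive-odd-odd x y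
        (go n x (suc y) (summand-≤ (x + suc y) (oo₁ x y) (m≤n⇒m≤o+n x (s≤s z≤n)) h) y<x)
        (go n (suc x) y (summand-≤ (suc x + y) (oo₂ x y) (s≤s z≤n) h) (m≤n⇒m≤1+n (<⇒≤ y<x)))
      where
      y<x : y < x
      y<x = half-< (s≤s⁻¹ b<a)
      oo₁ : ∀ x y → suc (x + x) + suc (y + y) ≡ (x + suc y) + (x + suc y)
      oo₁ = solve-∀
      oo₂ : ∀ x y → suc (x + x) + suc (y + y) ≡ (suc x + y) + (suc x + y)
      oo₂ = solve-∀

-- Colex initial segments as segments of binary expansions.

module ColexInitialSegments where
  open import Data.Bool using (Bool; true; false)
  open import Data.Empty using (⊥-elim)
  open import Data.List using (List; []; _∷_; _++_; map; length)
  import Data.List.Membership.DecPropositional as DecMembership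
  open import Data.List.Membership.Propositional using () renaming (_∈_ to _∈ℓ_)
  open import Data.List.Membership.Propositional.Properties using (∈-∃++; ∈-++⁺ˡ; ∈-++⁺ʳ; ∈-++⁻)
  open import Data.List.Properties using (map-++; ≡-dec)
  open import Data.List.Relation.Unary.All as All using (All; []; _∷_)
  open import Data.List.Relation.Unary.AllPairs using ([]; _∷_)
  open import Data.List.Relation.Unary.Any using (here; there)
  open import Data.List.Relation.Unary.Linked as Linked using (Linked; []; [-]; _∷_)
  open import Data.List.Relation.Unary.Unique.Propositional using (Unique)
  open import Data.Nat
  open import Data.Nat.ListAction using (sum)
  open import Data.Nat.ListAction.Properties using (sum-++)
  open import Data.Nat.Properties
  open import Data.Nat.Tactic.RingSolver using (solve-∀)
  open import Data.Product using (∃; _×_; _,_; proj₁; proj₂)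
  open import Data.Sum using (inj₁; inj₂)
  open import Function using (_∘_)
  open import Relation.Binary.Definitions using (tri<; tri≈; tri>)
  open import Relation.Binary.PropositionalEquality
  open import Relation.Nullary using (yes; no; ¬_)
  open BinaryDigitSums

  sum-mono-⊆ : ∀ {A : Set} (f : A → ℕ) {xs ys} → Unique xs → (∀ {x} → x ∈ℓ xs → x ∈ℓ ys) →
               sum (map f xs) ≤ sum (map f ys)
  sum-mono-⊆ f {[]} _ _ = z≤n
  sum-mono-⊆ f {x ∷ xs} (x≢ ∷ uniq) sub with ∈-∃++ (sub (here refl))
  ... | as , bs , refl = begin
    f x + sum (map f xs)                       ≤⟨ +-monoʳ-≤ (f x) (sum-mono-⊆ f uniq sub′) ⟩
    f x + sum (map f (as ++ bs))               ≡⟨ cong (f x +_) (sum-map-++ as bs) ⟩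
    f x + (sum (map f as) + sum (map f bs))    ≡⟨ swap (f x) (sum (map f as)) _ ⟩
    sum (map f as) + (f x + sum (map f bs))    ≡⟨ sum-map-++ as (x ∷ bs) ⟨
    sum (map f (as ++ x ∷ bs))                 ∎
    where
    open ≤-Reasoning
    sum-map-++ : ∀ us vs → sum (map f (us ++ vs)) ≡ sum (map f us) + sum (map f vs)
    sum-map-++ us vs = trans (cong sum (map-++ f us vs)) (sum-++ (map f us) (map f vs))
    swap : ∀ a b c → a + (b + c) ≡ b + (a + c)
    swap = solve-∀
    sub′ : ∀ {y} → y ∈ℓ xs → y ∈ℓ as ++ bs
    sub′ y∈xs with ∈-++⁻ as (sub (there y∈xs))
    ... | inj₁ y∈as = ∈-++⁺ˡ y∈as
    ... | inj₂ (here refl) = ⊥-elim (All.lookup x≢ y∈xs refl)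
    ... | inj₂ (there y∈bs) = ∈-++⁺ʳ as y∈bs

  length-mono-⊆ : ∀ {A : Set} {xs ys : List A} → Unique xs → (∀ {x} → x ∈ℓ xs → x ∈ℓ ys) →
                  length xs ≤ length ys
  length-mono-⊆ {xs = xs} {ys} uniq sub =
    subst₂ _≤_ (count≡length xs) (count≡length ys) (sum-mono-⊆ (λ _ → 1) uniq sub)
    where
    count≡length : ∀ zs → sum (map (λ _ → 1) zs) ≡ length zs
    count≡length [] = refl
    count≡length (_ ∷ zs) = cong suc (count≡length zs)

  value : List Bool → ℕ
  value [] = 0
  value (b ∷ bs) = ⟦ b ⟧ + (value bs + value bs)

  -- The bits record membership of k + 1, k + 2, …, least significant first.
  elements : ℕ → List Bool → List ℕ
  elements k [] = []
  elements k (true ∷ bs) = suc k ∷ elements (suc k) bs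
  elements k (false ∷ bs) = elements (suc k) bs

  value-increment : ∀ bs → value (increment bs) ≡ suc (value bs)
  value-increment [] = refl
  value-increment (false ∷ bs) = refl
  value-increment (true ∷ bs) rewrite value-increment bs = cong suc (+-suc (value bs) (value bs))

  value-binary : ∀ n → value (binary n) ≡ n
  value-binary zero = refl
  value-binary (suc n) = trans (value-increment (binary n)) (cong suc (value-binary n))

  length-elements : ∀ k bs → length (elements k bs) ≡ ones bs
  length-elements k [] = refl
  length-elements k (true ∷ bs) = cong suc (length-elements (suc k) bs)
  length-elements k (false ∷ bs) = length-elements (suc k) bs

  elements-lower : ∀ k bs {y} → y ∈ℓ elements k bs → k < y
  elements-lower k (true ∷ bs) (here refl) = ≤-refl
  elements-lower k (true ∷ bs) (there y∈) = <-trans (n<1+n k) (elements-lower (suc k) bs y∈)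
  elements-lower k (false ∷ bs) y∈ = <-trans (n<1+n k) (elements-lower (suc k) bs y∈)

  ∈-elements-∷ : ∀ k b bs {y} → y ∈ℓ elements (suc k) bs → y ∈ℓ elements k (b ∷ bs)
  ∈-elements-∷ k true bs = there
  ∈-elements-∷ k false bs = λ y∈ → y∈

  ∈-elements-tail : ∀ k b bs {y} → suc k < y → y ∈ℓ elements k (b ∷ bs) → y ∈ℓ elements (suc k) bs
  ∈-elements-tail k true bs k<y (here refl) = ⊥-elim (<-irrefl refl k<y)
  ∈-elements-tail k true bs k<y (there y∈) = y∈
  ∈-elements-tail k false bs k<y y∈ = y∈

  Linked-weakenHead : ∀ {k xs} → Linked _<_ (suc k ∷ xs) → Linked _<_ (k ∷ xs)
  Linked-weakenHead [-] = [-]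
  Linked-weakenHead (k<x ∷ l) = <-trans (n<1+n _) k<x ∷ l

  elements-linked : ∀ k bs → Linked _<_ (k ∷ elements k bs)
  elements-linked k [] = [-]
  elements-linked k (true ∷ bs) = ≤-refl ∷ elements-linked (suc k) bs
  elements-linked k (false ∷ bs) = Linked-weakenHead (elements-linked (suc k) bs)

  elements-isPosSet : ∀ bs → IsPosSet (elements 0 bs)
  elements-isPosSet bs = Linked.tail (elements-linked 0 bs) , All.tabulate (elements-lower 0 bs)

  -- Putting `k` in front of the list expresses in one hypothesis that it increases and lies above
  -- `k`. A gap before the next element is filled with `false` digits, counted by `d` in `skip`.
  elements-surjective : ∀ k xs → Linked _<_ (k ∷ xs) → ∃ λ bs → elements k bs ≡ xs
  elements-surjective k [] _ = [] , refl
  elements-surjective k (x ∷ xs) (k<x ∷ l) = skip k (x ∸ suc k) (m∸n+n≡m k<x)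
    where
    skip : ∀ k d → d + suc k ≡ x → ∃ λ bs → elements k bs ≡ x ∷ xs
    skip k zero refl with elements-surjective x xs l
    ... | bs , refl = true ∷ bs , refl
    skip k (suc d) eq with skip (suc k) d (trans (+-suc d (suc k)) eq)
    ... | bs , eq′ = false ∷ bs , eq′

  elements-value : ∀ k as bs → value as ≡ value bs → elements k as ≡ elements k bs
  elements-value k [] [] eq = refl
  elements-value k [] (false ∷ bs) eq = elements-value (suc k) [] bs (sym (m+n≡0⇒m≡0 (value bs) (sym eq)))
  elements-value k (false ∷ as) [] eq = elements-value (suc k) as [] (m+n≡0⇒m≡0 (value as) eq)
  elements-value k (a ∷ as) (b ∷ bs) eq =
    head-tail a b (digit-injective a b value-eq eq) (elements-value (suc k) as bs value-eq)
    where
    value-eq : value as ≡ value bs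
    value-eq = ≤-antisym (digit-≤ a b (≤-reflexive eq)) (digit-≤ b a (≤-reflexive (sym eq)))
    head-tail : ∀ a b → a ≡ b → elements (suc k) as ≡ elements (suc k) bs →
                elements k (a ∷ as) ≡ elements k (b ∷ bs)
    head-tail true _ refl e = cong (suc k ∷_) e
    head-tail false _ refl e = e

  <colex-∷ : ∀ k a as b bs → elements (suc k) as <colex elements (suc k) bs →
             elements k (a ∷ as) <colex elements k (b ∷ bs)
  <colex-∷ k a as b bs (x , x∈ , x∉ , agree) =
    x , ∈-elements-∷ k b bs x∈ , x∉ ∘ ∈-elements-tail k a as k<x , λ y x<y →
      (∈-elements-∷ k b bs ∘ proj₁ (agree y x<y) ∘ ∈-elements-tail k a as (<-trans k<x x<y)) ,
      (∈-elements-∷ k a as ∘ proj₂ (agree y x<y) ∘ ∈-elements-tail k b bs (<-trans k<x x<y))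
    where
    k<x = elements-lower (suc k) bs x∈

  -- The higher digits decide both orders unless they have equal value, and then the lowest digit
  -- must be `false` against `true`. The induction hypothesis is an argument so that the empty list
  -- can be treated as `false ∷ []`.
  elements-<colex-step : ∀ k a as b bs → value (a ∷ as) < value (b ∷ bs) →
    (value as < value bs → elements (suc k) as <colex elements (suc k) bs) →
    elements k (a ∷ as) <colex elements k (b ∷ bs)
  elements-<colex-step k a as b bs h rec with m≤n⇒m<n∨m≡n (digit-≤ {value as} {value bs} a b (<⇒≤ h))
  ... | inj₁ lt = <colex-∷ k a as b bs (rec lt)
  elements-<colex-step k false as true bs h rec | inj₂ eq =
    suc k , here refl , (λ x∈ → <-irrefl refl (elements-lower (suc k) as x∈)) ,
    λ y k<y → (λ y∈ → there (subst (y ∈ℓ_) tails y∈)) ,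
              (λ y∈ → subst (y ∈ℓ_) (sym tails) (∈-elements-tail k true bs k<y y∈))
    where
    tails = elements-value (suc k) as bs eq
  elements-<colex-step k true as true bs h rec | inj₂ eq = ⊥-elim (<-irrefl (cong (λ v → suc (v + v)) eq) h)
  elements-<colex-step k true as false bs h rec | inj₂ eq = ⊥-elim (<-irrefl (cong (λ v → v + v) eq) h′)
    where
    h′ = <-trans (n<1+n _) h
  elements-<colex-step k false as false bs h rec | inj₂ eq = ⊥-elim (<-irrefl (cong (λ v → v + v) eq) h)

  elements-<colex : ∀ k as bs → value as < value bs → elements k as <colex elements k bs
  elements-<colex k as [] ()
  elements-<colex k [] (b ∷ bs) h = elements-<colex-step k false [] b bs h (elements-<colex (suc k) [] bs)
  elements-<colex k (a ∷ as) (b ∷ bs) h = elements-<colex-step k a as b bs h (elements-<colex (suc k) as bs)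

  <colex-irreflexive : ∀ {A B} → A ≡ B → ¬ A <colex B
  <colex-irreflexive refl (_ , x∈ , x∉ , _) = x∉ x∈

  nthSet : ℕ → List ℕ
  nthSet n = elements 0 (binary n)

  nthSet-increasing : ∀ {i j} → i < j → nthSet i <colex nthSet j
  nthSet-increasing {i} {j} i<j = elements-<colex 0 (binary i) (binary j)
    (subst₂ _<_ (sym (value-binary i)) (sym (value-binary j)) i<j)

  nthSet-surjective : ∀ {A} → IsPosSet A → ∃ λ n → A ≡ nthSet n
  nthSet-surjective {A} (linked , positive) with elements-surjective 0 A (cons linked positive)
    where
    cons : ∀ {xs} → Linked _<_ xs → All (1 ≤_) xs → Linked _<_ (0 ∷ xs)
    cons {[]} _ _ = [-]
    cons {_ ∷ _} l (p ∷ _) = p ∷ l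
  ... | bs , refl = value bs , elements-value 0 bs (binary (value bs)) (sym (value-binary (value bs)))

  firstSets : ℕ → List (List ℕ)
  firstSets zero = []
  firstSets (suc n) = nthSet n ∷ firstSets n

  ∈-firstSets⁺ : ∀ {i n} → i < n → nthSet i ∈ℓ firstSets n
  ∈-firstSets⁺ {i} {suc n} i<n with m≤n⇒m<n∨m≡n i<n
  ... | inj₁ (s≤s h) = there (∈-firstSets⁺ h)
  ... | inj₂ refl = here refl

  ∈-firstSets⁻ : ∀ n {A} → A ∈ℓ firstSets n → ∃ λ i → i < n × A ≡ nthSet i
  ∈-firstSets⁻ (suc n) (here eq) = n , ≤-refl , eq
  ∈-firstSets⁻ (suc n) (there A∈) with ∈-firstSets⁻ n A∈
  ... | i , i<n , eq = i , m<n⇒m<1+n i<n , eq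

  firstSets-unique : ∀ n → Unique (firstSets n)
  firstSets-unique zero = []
  firstSets-unique (suc n) = All.tabulate fresh ∷ firstSets-unique n
    where
    fresh : ∀ {A} → A ∈ℓ firstSets n → nthSet n ≢ A
    fresh A∈ eq with ∈-firstSets⁻ n A∈
    ... | i , i<n , eq′ = <colex-irreflexive (sym (trans eq eq′)) (nthSet-increasing i<n)

  length-firstSets : ∀ n → length (firstSets n) ≡ n
  length-firstSets zero = refl
  length-firstSets (suc n) = cong suc (length-firstSets n)

  weight-firstSets : ∀ n → weightℕ (firstSets n) ≡ g n
  weight-firstSets zero = refl
  weight-firstSets (suc n) = trans (cong₂ _+_ (length-elements 0 (binary n)) (weight-firstSets n)) (+-comm _ (g n))

  -- Pigeonhole: if the set number i < m were missing, initiality would confine 𝓘 to the i sets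
  -- before it, too few for its length. So 𝓘 contains the first m sets, and containment is enough
  -- for this inequality.
  g≤weight : ∀ {m 𝓘} → IsColexInitial m 𝓘 → g m ≤ weightℕ 𝓘
  g≤weight {m} {𝓘} (unique , refl , posSets , initial) =
    subst (_≤ weightℕ 𝓘) (weight-firstSets m) (sum-mono-⊆ length (firstSets-unique m) firstSets⊆𝓘)
    where
    open DecMembership (≡-dec _≟_) using (_∈?_)
    nthSet∈𝓘 : ∀ {i} → i < m → nthSet i ∈ℓ 𝓘
    nthSet∈𝓘 {i} i<m with nthSet i ∈? 𝓘
    ... | yes p = p
    ... | no i∉ = ⊥-elim (<-irrefl refl (<-≤-trans i<m
            (subst (m ≤_) (length-firstSets i) (length-mono-⊆ unique below))))
      where
      below : ∀ {A} → A ∈ℓ 𝓘 → A ∈ℓ firstSets i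
      below A∈ with nthSet-surjective (All.lookup posSets A∈)
      ... | j , refl with <-cmp j i
      ... | tri< j<i _ _ = ∈-firstSets⁺ j<i
      ... | tri≈ _ refl _ = ⊥-elim (i∉ A∈)
      ... | tri> _ _ i<j = ⊥-elim (i∉ (initial _ A∈ _ (elements-isPosSet (binary i)) (nthSet-increasing i<j)))
    firstSets⊆𝓘 : ∀ {A} → A ∈ℓ firstSets m → A ∈ℓ 𝓘
    firstSets⊆𝓘 A∈ with ∈-firstSets⁻ m A∈
    ... | i , i<m , refl = nthSet∈𝓘 i<m

-- Counts and weights of families on the cube, by sections.

module CubeFamilies where
  open import Data.Bool using (Bool; true; false; _∧_; _∨_; not; T)
  open import Data.Bool.Properties using (T-∧; T-∨)
  open import Data.Empty using (⊥-elim)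
  open import Data.Fin as Fin using (Fin; toℕ)
  open import Data.Fin.Subset using (Subset; _∈_; _∪_; _∩_; ⊤; ⊥)
  open import Data.Fin.Subset.Properties using (∩-identityʳ; ∪-idem; ∪-assoc; ∪-identityʳ; ∉⊥; drop-there)
  open import Data.List using ([]; _∷_)
  open import Data.Nat hiding (_⊓_; _⊔_)
  open import Data.Nat.Properties
  open import Data.Nat.Tactic.RingSolver using (solve-∀)
  open import Data.Product using (∃; _×_; _,_; proj₁; proj₂)
  open import Data.Sum using (_⊎_; inj₁; inj₂)
  open import Data.Vec using ([]; _∷_; here; there)
  open import Function using (_∘_)
  open import Function.Bundles using (Equivalence)
  open import Relation.Binary.PropositionalEquality
  open BinaryDigitSums

  Fam : ℕ → Set
  Fam n = Subset n → Bool

  private variable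
    n : ℕ
    F G H : Fam n

  lo hi : Fam (suc n) → Fam n
  lo F v = F (false ∷ v)
  hi F v = F (true ∷ v)

  infixr 7 _⊓_
  infixr 6 _⊔_
  _⊓_ _⊔_ : Fam n → Fam n → Fam n
  (F ⊓ G) v = F v ∧ G v
  (F ⊔ G) v = F v ∨ G v

  ∁ : Fam n → Fam n
  ∁ F v = not (F v)

  infix 4 _⊑_
  _⊑_ : Fam n → Fam n → Set
  F ⊑ G = ∀ v → T (F v) → T (G v)

  UnionClosed Up : Fam n → Set
  UnionClosed F = ∀ v w → T (F v) → T (F w) → T (F (v ∪ w))
  Up F = ∀ v w → T (F v) → T (F (v ∪ w))

  ∧⁺ : ∀ {a b} → T a → T b → T (a ∧ b)
  ∧⁺ p q = Equivalence.from T-∧ (p , q)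

  ∧⁻ : ∀ {a b} → T (a ∧ b) → T a × T b
  ∧⁻ = Equivalence.to T-∧

  ∨⁺ˡ : ∀ {a b} → T a → T (a ∨ b)
  ∨⁺ˡ p = Equivalence.from T-∨ (inj₁ p)

  ∨⁺ʳ : ∀ {a b} → T b → T (a ∨ b)
  ∨⁺ʳ {a} p = Equivalence.from (T-∨ {a}) (inj₂ p)

  ∨⁻ : ∀ {a b} → T (a ∨ b) → T a ⊎ T b
  ∨⁻ = Equivalence.to T-∨

  #_ : Fam n → ℕ
  #_ {zero} F = ⟦ F [] ⟧
  #_ {suc n} F = # lo F + # hi F

  wt : Fam n → ℕ
  wt {zero} F = 0
  wt {suc n} F = wt (lo F) + wt (hi F) + # hi F

  -- Having two families on either side reduces the inclusion-exclusion counts below to a Boolean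
  -- case check at one point; a lone count is padded with the empty family.
  #-additive : ∀ {n} {F G H K : Fam n} → (∀ v → ⟦ F v ⟧ + ⟦ G v ⟧ ≡ ⟦ H v ⟧ + ⟦ K v ⟧) →
               # F + # G ≡ # H + # K
  #-additive {zero} e = e []
  #-additive {suc n} {F} {G} {H} {K} e = begin
    (# lo F + # hi F) + (# lo G + # hi G) ≡⟨ interchange (# lo F) (# hi F) (# lo G) (# hi G) ⟩
    (# lo F + # lo G) + (# hi F + # hi G) ≡⟨ cong₂ _+_ (#-additive (e ∘ (false ∷_))) (#-additive (e ∘ (true ∷_))) ⟩
    (# lo H + # lo K) + (# hi H + # hi K) ≡⟨ interchange (# lo H) (# lo K) (# hi H) (# hi K) ⟩
    (# lo H + # hi H) + (# lo K + # hi K) ∎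
    where
    open ≡-Reasoning
    interchange : ∀ a b c d → (a + b) + (c + d) ≡ (a + c) + (b + d)
    interchange = solve-∀

  wt-additive : ∀ {n} {F G H K : Fam n} → (∀ v → ⟦ F v ⟧ + ⟦ G v ⟧ ≡ ⟦ H v ⟧ + ⟦ K v ⟧) →
                wt F + wt G ≡ wt H + wt K
  wt-additive {zero} e = refl
  wt-additive {suc n} {F} {G} {H} {K} e = begin
    (wt (lo F) + wt (hi F) + # hi F) + (wt (lo G) + wt (hi G) + # hi G)
      ≡⟨ interchange (wt (lo F)) _ _ (wt (lo G)) _ _ ⟩
    (wt (lo F) + wt (lo G)) + (wt (hi F) + wt (hi G)) + (# hi F + # hi G)
      ≡⟨ cong₂ _+_ (cong₂ _+_ (wt-additive (e ∘ (false ∷_))) (wt-additive (e ∘ (true ∷_))))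
                   (#-additive (e ∘ (true ∷_))) ⟩
    (wt (lo H) + wt (lo K)) + (wt (hi H) + wt (hi K)) + (# hi H + # hi K)
      ≡⟨ interchange (wt (lo H)) _ _ (wt (lo K)) _ _ ⟨
    (wt (lo H) + wt (hi H) + # hi H) + (wt (lo K) + wt (hi K) + # hi K) ∎
    where
    open ≡-Reasoning
    interchange : ∀ a b c a′ b′ c′ → (a + b + c) + (a′ + b′ + c′) ≡ (a + a′) + (b + b′) + (c + c′)
    interchange = solve-∀

  #-mono : ∀ {n} {F G : Fam n} → F ⊑ G → # F ≤ # G
  #-mono {zero} {F} {G} h with F [] | G [] | h []
  ... | false | _ | _ = z≤n
  ... | true | true | _ = s≤s z≤n
  ... | true | false | h′ with () ← h′ _
  #-mono {suc n} h = +-mono-≤ (#-mono (h ∘ (false ∷_))) (#-mono (h ∘ (true ∷_)))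

  #-∅ : ∀ n → # (λ (_ : Subset n) → false) ≡ 0
  #-∅ zero = refl
  #-∅ (suc n) rewrite #-∅ n = refl

  #-disjoint : ∀ {n} {F G H : Fam n} → F ⊑ H → G ⊑ H → (∀ v → T (F v) → T (G v) → T false) →
               # F + # G ≤ # H
  #-disjoint {n} {F} {G} {H} p q d = begin
    # F + # G                            ≡⟨ #-additive {H = F ⊔ G} {K = λ _ → false} (λ v → exclusive (F v) (G v) (d v)) ⟩
    # (F ⊔ G) + # (λ (_ : Subset n) → false) ≡⟨ cong (# (F ⊔ G) +_) (#-∅ n) ⟩
    # (F ⊔ G) + 0                        ≡⟨ +-identityʳ _ ⟩
    # (F ⊔ G)                            ≤⟨ #-mono F⊔G⊑H ⟩
    # H                                  ∎
    where
    open ≤-Reasoning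
    exclusive : ∀ a b → (T a → T b → T false) → ⟦ a ⟧ + ⟦ b ⟧ ≡ ⟦ a ∨ b ⟧ + 0
    exclusive false false _ = refl
    exclusive false true _ = refl
    exclusive true false _ = refl
    exclusive true true h with () ← h _ _
    F⊔G⊑H : F ⊔ G ⊑ H
    F⊔G⊑H v h with ∨⁻ h
    ... | inj₁ f = p v f
    ... | inj₂ g = q v g

  -- Up-closure and up-compression.

  -- The up-set generated by `F`, written with the recursion of `compress` so that the two can be
  -- compared section by section.
  up : Fam n → Fam n
  up {zero} F = F
  up {suc n} F (false ∷ v) = up (lo F) v
  up {suc n} F (true ∷ v) = up (lo F ⊔ hi F) v

  -- Reimer's up-compressions, one coordinate after the other.
  compress : Fam n → Fam n
  compress {zero} F = F
  compress {suc n} F (false ∷ v) = compress (lo F ⊓ hi F) v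
  compress {suc n} F (true ∷ v) = compress (lo F ⊔ hi F) v

  ⊓⊑⊔ : (F G : Fam n) → F ⊓ G ⊑ F ⊔ G
  ⊓⊑⊔ F G v h = ∨⁺ˡ {F v} (proj₁ (∧⁻ {F v} h))

  ⊓-mono : ∀ {F F′ G G′ : Fam n} → F ⊑ F′ → G ⊑ G′ → F ⊓ G ⊑ F′ ⊓ G′
  ⊓-mono p q v h = ∧⁺ (p v (proj₁ (∧⁻ h))) (q v (proj₂ (∧⁻ h)))

  ⊔-mono : ∀ {F F′ G G′ : Fam n} → F ⊑ F′ → G ⊑ G′ → F ⊔ G ⊑ F′ ⊔ G′
  ⊔-mono {F′ = F′} p q v h with ∨⁻ h
  ... | inj₁ f = ∨⁺ˡ (p v f)
  ... | inj₂ g = ∨⁺ʳ {F′ v} (q v g)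

  up-mono : ∀ {n} {F G : Fam n} → F ⊑ G → up F ⊑ up G
  up-mono {zero} h = h
  up-mono {suc n} h (false ∷ v) = up-mono (λ w → h (false ∷ w)) v
  up-mono {suc n} h (true ∷ v) = up-mono (⊔-mono (λ w → h (false ∷ w)) (λ w → h (true ∷ w))) v

  compress-mono : ∀ {n} {F G : Fam n} → F ⊑ G → compress F ⊑ compress G
  compress-mono {zero} h = h
  compress-mono {suc n} h (false ∷ v) = compress-mono (⊓-mono (λ w → h (false ∷ w)) (λ w → h (true ∷ w))) v
  compress-mono {suc n} h (true ∷ v) = compress-mono (⊔-mono (λ w → h (false ∷ w)) (λ w → h (true ∷ w))) v

  up-extensive : ∀ {n} (F : Fam n) → F ⊑ up F
  up-extensive {zero} F v f = f
  up-extensive {suc n} F (false ∷ v) f = up-extensive (lo F) v f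
  up-extensive {suc n} F (true ∷ v) f = up-extensive (lo F ⊔ hi F) v (∨⁺ʳ {lo F v} f)

  up-isUp : ∀ {n} (F : Fam n) → Up (up F)
  up-isUp {zero} F [] [] f = f
  up-isUp {suc n} F (false ∷ v) (false ∷ w) f = up-isUp (lo F) v w f
  up-isUp {suc n} F (false ∷ v) (true ∷ w) f =
    up-mono {F = lo F} (λ _ → ∨⁺ˡ) (v ∪ w) (up-isUp (lo F) v w f)
  up-isUp {suc n} F (true ∷ v) (_ ∷ w) f = up-isUp (lo F ⊔ hi F) v w f

  up⁻ : ∀ {n} (F : Fam n) v → T (up F v) → ∃ λ w → T (F w) × v ∪ w ≡ v
  up⁻ {zero} F [] f = [] , f , refl
  up⁻ {suc n} F (false ∷ v) f with up⁻ (lo F) v f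
  ... | w , h , e = false ∷ w , h , cong (false ∷_) e
  up⁻ {suc n} F (true ∷ v) f with up⁻ (lo F ⊔ hi F) v f
  ... | w , h , e with ∨⁻ h
  ... | inj₁ h₀ = false ∷ w , h₀ , cong (true ∷_) e
  ... | inj₂ h₁ = true ∷ w , h₁ , cong (true ∷_) e

  compress-isUp : ∀ {n} (F : Fam n) → Up (compress F)
  compress-isUp {zero} F [] [] f = f
  compress-isUp {suc n} F (false ∷ v) (false ∷ w) f = compress-isUp (lo F ⊓ hi F) v w f
  compress-isUp {suc n} F (false ∷ v) (true ∷ w) f =
    compress-mono (⊓⊑⊔ (lo F) (hi F)) (v ∪ w) (compress-isUp (lo F ⊓ hi F) v w f)
  compress-isUp {suc n} F (true ∷ v) (_ ∷ w) f = compress-isUp (lo F ⊔ hi F) v w f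

  compress⊑up : ∀ {n} (F : Fam n) → compress F ⊑ up F
  compress⊑up {zero} F v f = f
  compress⊑up {suc n} F (false ∷ v) f =
    up-mono {G = lo F} (λ _ → proj₁ ∘ ∧⁻) v (compress⊑up (lo F ⊓ hi F) v f)
  compress⊑up {suc n} F (true ∷ v) f = compress⊑up (lo F ⊔ hi F) v f

  modular : ∀ a b → ⟦ not (a ∧ b) ⟧ + ⟦ not (a ∨ b) ⟧ ≡ ⟦ not a ⟧ + ⟦ not b ⟧
  modular true true = refl
  modular true false = refl
  modular false true = refl
  modular false false = refl

  difference : ∀ a b → ⟦ not b ⟧ + 0 ≡ ⟦ not (a ∨ b) ⟧ + ⟦ a ∧ not b ⟧
  difference true true = refl
  difference true false = refl
  difference false true = refl
  difference false false = refl

  #∁-compress : ∀ {n} (F : Fam n) → # ∁ (compress F) ≡ # ∁ F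
  #∁-compress {zero} F = refl
  #∁-compress {suc n} F = begin
    # ∁ (compress (lo F ⊓ hi F)) + # ∁ (compress (lo F ⊔ hi F))
      ≡⟨ cong₂ _+_ (#∁-compress (lo F ⊓ hi F)) (#∁-compress (lo F ⊔ hi F)) ⟩
    # ∁ (lo F ⊓ hi F) + # ∁ (lo F ⊔ hi F)
      ≡⟨ #-additive (λ v → modular (lo F v) (hi F v)) ⟩
    # ∁ (lo F) + # ∁ (hi F) ∎
    where open ≡-Reasoning

  -- Negative correlation of up-sets and down-sets.

  -- The two sides differ by exactly (p₁ - p₀)(q₀ - q₁), the product `s * t` of the two gaps.
  chebyshev : ∀ {p₀ p₁ q₀ q₁} → p₀ ≤ p₁ → q₁ ≤ q₀ →
              2 * (p₀ * q₀ + p₁ * q₁) ≤ (p₀ + p₁) * (q₀ + q₁)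
  chebyshev {p₀} {p₁} {q₀} {q₁} p q with m≤n⇒∃[o]m+o≡n p | m≤n⇒∃[o]m+o≡n q
  ... | s , refl | t , refl = begin
    2 * (p₀ * (q₁ + t) + (p₀ + s) * q₁)         ≤⟨ m≤m+n _ (s * t) ⟩
    2 * (p₀ * (q₁ + t) + (p₀ + s) * q₁) + s * t ≡⟨ expand p₀ s q₁ t ⟩
    (p₀ + (p₀ + s)) * (q₁ + t + q₁)             ∎
    where
    open ≤-Reasoning
    expand : ∀ p s q t → 2 * (p * (q + t) + (p + s) * q) + s * t ≡ (p + (p + s)) * (q + t + q)
    expand = solve-∀

  up-lo⊑hi : {P : Fam (suc n)} → Up P → lo P ⊑ hi P
  up-lo⊑hi {P = P} upP v p = subst (λ w → T (P (true ∷ w))) (∪-idem v) (upP (false ∷ v) (true ∷ v) p)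

  ∁-anti : F ⊑ G → ∁ G ⊑ ∁ F
  ∁-anti {F = F} {G} h v = contra (F v) (G v) (h v)
    where
    contra : ∀ a b → (T a → T b) → T (not b) → T (not a)
    contra false b _ _ = _
    contra true true h ()
    contra true false h _ = h _

  -- In each coordinate the sections of the up-set `P` grow and those of the down-set `∁ V` shrink,
  -- so `chebyshev` glues the bounds for the two halves of the cube.
  kleitman : ∀ {n} {P V : Fam n} → Up P → Up V → 2 ^ n * # (P ⊓ ∁ V) ≤ # P * # ∁ V
  kleitman {zero} {P} {V} _ _ = base (P []) (V [])
    where
    base : ∀ a b → 1 * ⟦ a ∧ not b ⟧ ≤ ⟦ a ⟧ * ⟦ not b ⟧
    base true true = z≤n
    base true false = ≤-refl
    base false b = z≤n
  kleitman {suc n} {P} {V} upP upV = begin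
    2 * 2 ^ n * (# (lo P ⊓ ∁ (lo V)) + # (hi P ⊓ ∁ (hi V)))
      ≡⟨ distribute (2 ^ n) (# (lo P ⊓ ∁ (lo V))) (# (hi P ⊓ ∁ (hi V))) ⟩
    2 * (2 ^ n * # (lo P ⊓ ∁ (lo V)) + 2 ^ n * # (hi P ⊓ ∁ (hi V)))
      ≤⟨ *-monoʳ-≤ 2 (+-mono-≤
           (kleitman (λ v w → upP (false ∷ v) (false ∷ w)) (λ v w → upV (false ∷ v) (false ∷ w)))
           (kleitman (λ v w → upP (true ∷ v) (true ∷ w)) (λ v w → upV (true ∷ v) (true ∷ w)))) ⟩
    2 * (# lo P * # ∁ (lo V) + # hi P * # ∁ (hi V))
      ≤⟨ chebyshev (#-mono (up-lo⊑hi upP)) (#-mono (∁-anti (up-lo⊑hi upV))) ⟩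
    (# lo P + # hi P) * (# ∁ (lo V) + # ∁ (hi V)) ∎
    where
    open ≤-Reasoning
    distribute : ∀ D a b → 2 * D * (a + b) ≡ 2 * (D * a + D * b)
    distribute = solve-∀

  not⁺ : ∀ {a} → (T a → T false) → T (not a)
  not⁺ {true} h = h _
  not⁺ {false} _ = _

  not⁻ : ∀ {a} → T (not a) → T a → T false
  not⁻ {true} h _ = h

  -- Within a family Q ⊒ N this says that N is an up-set relative to Q.
  RelUp : Fam n → Fam n → Set
  RelUp N Q = ∀ v w → T (N v) → T (Q (v ∪ w)) → T (N (v ∪ w))

  #-absorb : ∀ {n} (F G : Fam n) → # ∁ G ≡ # ∁ (F ⊔ G) + # (F ⊓ ∁ G)
  #-absorb {n} F G = begin
    # ∁ G                                  ≡⟨ +-identityʳ _ ⟨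
    # ∁ G + 0                              ≡⟨ cong (# ∁ G +_) (#-∅ n) ⟨
    # ∁ G + # (λ (_ : Subset n) → false)   ≡⟨ #-additive (λ v → difference (F v) (G v)) ⟩
    # ∁ (F ⊔ G) + # (F ⊓ ∁ G)              ∎
    where open ≡-Reasoning

  module Sections {n} {Q : Fam (suc n)} (ucQ : UnionClosed Q) where

    meet-unionClosed : UnionClosed (lo Q ⊓ hi Q)
    meet-unionClosed v w p q with ∧⁻ {lo Q v} p | ∧⁻ {lo Q w} q
    ... | p₀ , p₁ | q₀ , q₁ = ∧⁺ (ucQ (false ∷ v) (false ∷ w) p₀ q₀) (ucQ (true ∷ v) (true ∷ w) p₁ q₁)

    join-unionClosed : UnionClosed (lo Q ⊔ hi Q)
    join-unionClosed v w p q with ∨⁻ {lo Q v} p | ∨⁻ {lo Q w} q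
    ... | inj₁ p₀ | inj₁ q₀ = ∨⁺ˡ {lo Q (v ∪ w)} (ucQ (false ∷ v) (false ∷ w) p₀ q₀)
    ... | inj₁ p₀ | inj₂ q₁ = ∨⁺ʳ {lo Q (v ∪ w)} (ucQ (false ∷ v) (true ∷ w) p₀ q₁)
    ... | inj₂ p₁ | inj₁ q₀ = ∨⁺ʳ {lo Q (v ∪ w)} (ucQ (true ∷ v) (false ∷ w) p₁ q₀)
    ... | inj₂ p₁ | inj₂ q₁ = ∨⁺ʳ {lo Q (v ∪ w)} (ucQ (true ∷ v) (true ∷ w) p₁ q₁)

  ∪-absorb : (v w : Subset n) → v ∪ (v ∪ w) ≡ v ∪ w
  ∪-absorb v w = trans (sym (∪-assoc v v w)) (cong (_∪ w) (∪-idem v))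

  -- Counting the sets lifted by compression.

  -- Compressing one coordinate lifts the sets counted by `# (lo N ⊓ ∁ (hi N))`, and the complement
  -- loses one unit of weight for each. The new sections of the complement have sizes c₀ ≥ c₁, and
  -- the c₁ sets of the upper one carry one extra element each: this is the term b in
  -- `g-superadditive`.
  section-step : ∀ {n} (N : Fam (suc n)) →
    wt (∁ N) + (g (# ∁ (lo N ⊓ hi N)) + g (# ∁ (lo N ⊔ hi N))) ≤
    g (# ∁ N) + (wt (∁ (lo N ⊓ hi N)) + wt (∁ (lo N ⊔ hi N)) + # (lo N ⊓ ∁ (hi N)))
  section-step N = begin
    wt (∁ (lo N)) + wt (∁ (hi N)) + # ∁ (hi N) + (g c₀ + g c₁)
      ≡⟨ cong (_+ (g c₀ + g c₁)) (cong₂ _+_ (wt-additive (λ v → modular (lo N v) (hi N v)))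
                                            (sym (#-absorb (lo N) (hi N)))) ⟨
    w₀ + w₁ + (c₁ + d) + (g c₀ + g c₁)
      ≡⟨ rearrange w₀ w₁ c₁ d (g c₀) (g c₁) ⟩
    (g c₀ + g c₁ + c₁) + (w₀ + w₁ + d)
      ≤⟨ +-monoˡ-≤ (w₀ + w₁ + d) (g-superadditive c₀ c₁ (#-mono (∁-anti (⊓⊑⊔ (lo N) (hi N))))) ⟩
    g (c₀ + c₁) + (w₀ + w₁ + d)
      ≡⟨ cong (λ c → g c + (w₀ + w₁ + d)) (#-additive (λ v → modular (lo N v) (hi N v))) ⟩
    g (# ∁ N) + (w₀ + w₁ + d) ∎
    where
    open ≤-Reasoning
    c₀ = # ∁ (lo N ⊓ hi N)
    c₁ = # ∁ (lo N ⊔ hi N)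
    w₀ = wt (∁ (lo N ⊓ hi N))
    w₁ = wt (∁ (lo N ⊔ hi N))
    d = # (lo N ⊓ ∁ (hi N))
    rearrange : ∀ a b c d x y → a + b + (c + d) + (x + y) ≡ (x + y + c) + (a + b + d)
    rearrange = solve-∀

  scaled-section-bound : ∀ D W G G₀ G₁ w₀ w₁ d {x₀ x₁ u₀ u₁} →
    W + (G₀ + G₁) ≤ G + (w₀ + w₁ + d) →
    D * w₀ ≤ D * (G₀ + x₀) + u₀ → D * w₁ ≤ D * (G₁ + x₁) + u₁ →
    D * W ≤ D * (G + (x₀ + x₁ + d)) + (u₀ + u₁)
  scaled-section-bound D W G G₀ G₁ w₀ w₁ d {x₀} {x₁} {u₀} {u₁} h h₀ h₁ =
    +-cancelˡ-≤ (D * (G₀ + G₁)) _ _ (begin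
    D * (G₀ + G₁) + D * W
      ≡⟨ collect D W G₀ G₁ ⟩
    D * (W + (G₀ + G₁))
      ≤⟨ *-monoʳ-≤ D h ⟩
    D * (G + (w₀ + w₁ + d))
      ≡⟨ distribute D G w₀ w₁ d ⟩
    (D * w₀ + D * w₁) + D * (G + d)
      ≤⟨ +-monoˡ-≤ (D * (G + d)) (+-mono-≤ h₀ h₁) ⟩
    ((D * (G₀ + x₀) + u₀) + (D * (G₁ + x₁) + u₁)) + D * (G + d)
      ≡⟨ rearrange D G d G₀ G₁ x₀ x₁ u₀ u₁ ⟩
    D * (G₀ + G₁) + (D * (G + (x₀ + x₁ + d)) + (u₀ + u₁)) ∎)
    where
    open ≤-Reasoning
    collect : ∀ D W G₀ G₁ → D * (G₀ + G₁) + D * W ≡ D * (W + (G₀ + G₁))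
    collect = solve-∀
    distribute : ∀ D G w₀ w₁ d → D * (G + (w₀ + w₁ + d)) ≡ (D * w₀ + D * w₁) + D * (G + d)
    distribute = solve-∀
    rearrange : ∀ D G d G₀ G₁ x₀ x₁ u₀ u₁ →
      ((D * (G₀ + x₀) + u₀) + (D * (G₁ + x₁) + u₁)) + D * (G + d) ≡
      D * (G₀ + G₁) + (D * (G + (x₀ + x₁ + d)) + (u₀ + u₁))
    rearrange = solve-∀

  section-bound : ∀ {n} (N : Fam (suc n)) {x y} →
           wt (∁ (lo N ⊓ hi N)) ≤ g (# ∁ (lo N ⊓ hi N)) + x →
           wt (∁ (lo N ⊔ hi N)) ≤ g (# ∁ (lo N ⊔ hi N)) + y →
           wt (∁ N) ≤ g (# ∁ N) + (x + y + # (lo N ⊓ ∁ (hi N)))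
  section-bound N {x} {y} h₀ h₁ = +-cancelʳ-≤ (g c₀ + g c₁) _ _ (begin
    wt (∁ N) + (g c₀ + g c₁)                                   ≤⟨ section-step N ⟩
    g (# ∁ N) + (wt (∁ (lo N ⊓ hi N)) + wt (∁ (lo N ⊔ hi N)) + d)
      ≤⟨ +-monoʳ-≤ (g (# ∁ N)) (+-monoˡ-≤ d (+-mono-≤ h₀ h₁)) ⟩
    g (# ∁ N) + ((g c₀ + x) + (g c₁ + y) + d)                  ≡⟨ rearrange (g (# ∁ N)) (g c₀) x (g c₁) y d ⟩
    g (# ∁ N) + (x + y + d) + (g c₀ + g c₁)                    ∎)
    where
    open ≤-Reasoning
    c₀ = # ∁ (lo N ⊓ hi N)
    c₁ = # ∁ (lo N ⊔ hi N)
    d = # (lo N ⊓ ∁ (hi N))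
    rearrange : ∀ G a x b y d → G + ((a + x) + (b + y) + d) ≡ G + (x + y + d) + (a + b)
    rearrange = solve-∀

  -- `P` acts as a budget around `N`. In the lower section it is cut down to `lo P ⊓ up Q₀`, and the
  -- sets lifted at this coordinate are charged to the part of `lo P` that is given up; they avoid
  -- `compress Q₀` because `compress Q₀ ⊑ up Q₀`. For `N = Q` and `P` the whole cube this is the
  -- bound without gain, in which every set outside `N` is charged.
  compression-bound : ∀ {n} {N P Q : Fam n} → Up P → N ⊑ P → N ⊑ Q → UnionClosed Q → RelUp N Q →
                      wt (∁ N) ≤ g (# ∁ N) + # (P ⊓ ∁ (compress Q))
  compression-bound {zero} _ _ _ _ _ = z≤n
  compression-bound {suc n} {N} {P} {Q} upP N⊑P N⊑Q ucQ rel = begin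
    wt (∁ N)
      ≤⟨ section-bound N
           (compression-bound up₀ N₀⊑P₀ N₀⊑Q₀ meet-unionClosed rel₀)
           (compression-bound up₁ N₁⊑P₁ N₁⊑Q₁ join-unionClosed rel₁) ⟩
    g (# ∁ N) + (# (P₀ ⊓ ∁ (compress Q₀)) + # (hi P ⊓ ∁ (compress Q₁)) + # (lo N ⊓ ∁ (hi N)))
      ≡⟨ cong (g (# ∁ N) +_) (rearrange (# (P₀ ⊓ ∁ (compress Q₀))) _ _) ⟩
    g (# ∁ N) + (# (P₀ ⊓ ∁ (compress Q₀)) + # (lo N ⊓ ∁ (hi N)) + # (hi P ⊓ ∁ (compress Q₁)))
      ≤⟨ +-monoʳ-≤ (g (# ∁ N)) (+-monoˡ-≤ _ (#-disjoint P₀-part N-part disjoint)) ⟩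
    g (# ∁ N) + # (P ⊓ ∁ (compress Q)) ∎
    where
    open ≤-Reasoning
    open Sections ucQ
    Q₀ = lo Q ⊓ hi Q
    Q₁ = lo Q ⊔ hi Q
    -- lo N ⊓ ∁ (hi N) avoids up Q₀, so it fits into the part of lo P that P₀ leaves out.
    P₀ = lo P ⊓ up Q₀

    rearrange : ∀ a b c → a + b + c ≡ a + c + b
    rearrange = solve-∀

    -- Below `v` there is some `w` that stays in `Q` when the current coordinate is added. Its union
    -- with `v` is `v` with that coordinate; it lies in `Q` by union-closedness, hence in `N` by
    -- relative closure.
    collide : ∀ v → T (lo N v) → T (up Q₀ v) → T (hi N v)
    collide v p u with up⁻ Q₀ v u
    ... | w , q , e = subst (T ∘ hi N) e
      (rel (false ∷ v) (true ∷ w) p (ucQ (false ∷ v) (true ∷ w) (N⊑Q (false ∷ v) p) (proj₂ (∧⁻ {lo Q w} q))))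

    up₀ : Up P₀
    up₀ v w p with ∧⁻ {lo P v} p
    ... | a , b = ∧⁺ (upP (false ∷ v) (false ∷ w) a) (up-isUp Q₀ v w b)

    up₁ : Up (hi P)
    up₁ v w = upP (true ∷ v) (true ∷ w)

    N₀⊑Q₀ : lo N ⊓ hi N ⊑ Q₀
    N₀⊑Q₀ = ⊓-mono (λ v → N⊑Q (false ∷ v)) (λ v → N⊑Q (true ∷ v))

    N₁⊑Q₁ : lo N ⊔ hi N ⊑ Q₁
    N₁⊑Q₁ = ⊔-mono (λ v → N⊑Q (false ∷ v)) (λ v → N⊑Q (true ∷ v))

    N₀⊑P₀ : lo N ⊓ hi N ⊑ P₀
    N₀⊑P₀ v p = ∧⁺ (N⊑P (false ∷ v) (proj₁ (∧⁻ {lo N v} p))) (up-extensive Q₀ v (N₀⊑Q₀ v p))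

    N₁⊑P₁ : lo N ⊔ hi N ⊑ hi P
    N₁⊑P₁ v p with ∨⁻ {lo N v} p
    ... | inj₁ q = up-lo⊑hi upP v (N⊑P (false ∷ v) q)
    ... | inj₂ q = N⊑P (true ∷ v) q

    rel₀ : RelUp (lo N ⊓ hi N) Q₀
    rel₀ v w p q with ∧⁻ {lo N v} p | ∧⁻ {lo Q (v ∪ w)} q
    ... | p₀ , p₁ | q₀ , q₁ = ∧⁺ (rel (false ∷ v) (false ∷ w) p₀ q₀) (rel (true ∷ v) (true ∷ w) p₁ q₁)

    rel₁ : RelUp (lo N ⊔ hi N) Q₁
    rel₁ v w p q with ∨⁻ {lo N v} p | ∨⁻ {lo Q (v ∪ w)} q
    ... | inj₁ p₀ | inj₁ q₀ = ∨⁺ˡ {lo N (v ∪ w)} (rel (false ∷ v) (false ∷ w) p₀ q₀)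
    ... | inj₁ p₀ | inj₂ q₁ = ∨⁺ʳ {lo N (v ∪ w)} (rel (false ∷ v) (true ∷ w) p₀ q₁)
    ... | inj₂ p₁ | inj₂ q₁ = ∨⁺ʳ {lo N (v ∪ w)} (rel (true ∷ v) (true ∷ w) p₁ q₁)
    -- The two memberships sit in different sections; uniting the set of `Q` with the set of `N`
    -- moves the former into the upper section, where `rel` applies.
    ... | inj₂ p₁ | inj₁ q₀ = ∨⁺ʳ {lo N (v ∪ w)} (rel (true ∷ v) (true ∷ w) p₁
      (subst (T ∘ hi Q) (∪-absorb v w) (ucQ (true ∷ v) (false ∷ (v ∪ w)) (N⊑Q (true ∷ v) p₁) q₀)))

    P₀-part : P₀ ⊓ ∁ (compress Q₀) ⊑ lo P ⊓ ∁ (compress Q₀)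
    P₀-part = ⊓-mono {F = P₀} (λ v → proj₁ ∘ ∧⁻ {lo P v}) (λ _ q → q)

    N-part : lo N ⊓ ∁ (hi N) ⊑ lo P ⊓ ∁ (compress Q₀)
    N-part v p with ∧⁻ {lo N v} p
    ... | p₀ , ¬p₁ = ∧⁺ (N⊑P (false ∷ v) p₀)
      (not⁺ λ c → not⁻ {hi N v} ¬p₁ (collide v p₀ (compress⊑up Q₀ v c)))

    disjoint : ∀ v → T ((P₀ ⊓ ∁ (compress Q₀)) v) → T ((lo N ⊓ ∁ (hi N)) v) → T false
    disjoint v p q with ∧⁻ {lo N v} q
    ... | p₀ , ¬p₁ = not⁻ {hi N v} ¬p₁ (collide v p₀ (proj₂ (∧⁻ {lo P v} (proj₁ (∧⁻ {P₀ v} p)))))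

  -- Compression in two stages, split at a threshold.

  UpFrom UpBelow : ℕ → Fam n → Set
  UpFrom k F = ∀ v w → (∀ i → i ∈ w → k ≤ toℕ i) → T (F v) → T (F (v ∪ w))
  UpBelow k F = ∀ v w → (∀ i → i ∈ w → toℕ i < k) → T (F v) → T (F (v ∪ w))

  -- The part of RelUp that survives compressing the coordinates below k: the sets of
  -- Q above a set of N may first have to be shrunk in those coordinates.
  Fillable : ℕ → Fam n → Fam n → Set
  Fillable k N Q = ∀ v w → T (N v) → T (Q (v ∪ w)) →
    ∃ λ D → (∀ i → k ≤ toℕ i → i ∈ D) × T (N (v ∪ (w ∩ D)))

  full : ∀ {n} (D : Subset n) → (∀ i → i ∈ D) → D ≡ ⊤
  full [] _ = refl
  full (b ∷ D) all with all Fin.zero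
  ... | here = cong (true ∷_) (full D (λ i → drop-there (all (Fin.suc i))))

  upBelow-lo⊑hi : ∀ {n k} {R : Fam (suc n)} → UpBelow (suc k) R → lo R ⊑ hi R
  upBelow-lo⊑hi {R = R} upR v r = subst (T ∘ hi R) (∪-identityʳ v) (upR (false ∷ v) (true ∷ ⊥)
    (λ { Fin.zero _ → s≤s z≤n ; (Fin.suc i) (there i∈⊥) → ⊥-elim (∉⊥ i∈⊥) }) r)

  module _ {n k : ℕ} where

    upFrom-section : ∀ b {F : Fam (suc n)} → UpFrom (suc k) F → UpFrom k (λ v → F (b ∷ v))
    upFrom-section true upF v w w≥k = upF (true ∷ v) (false ∷ w)
      λ { (Fin.suc i) (there i∈w) → s≤s (w≥k i i∈w) }
    upFrom-section false upF v w w≥k = upF (false ∷ v) (false ∷ w)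
      λ { (Fin.suc i) (there i∈w) → s≤s (w≥k i i∈w) }

    upBelow-section : ∀ b {F : Fam (suc n)} → UpBelow (suc k) F → UpBelow k (λ v → F (b ∷ v))
    upBelow-section true upF v w w<k = upF (true ∷ v) (false ∷ w)
      λ { (Fin.suc i) (there i∈w) → s≤s (w<k i i∈w) }
    upBelow-section false upF v w w<k = upF (false ∷ v) (false ∷ w)
      λ { (Fin.suc i) (there i∈w) → s≤s (w<k i i∈w) }

    upFrom-⊓ : ∀ {F G : Fam n} → UpFrom k F → UpFrom k G → UpFrom k (F ⊓ G)
    upFrom-⊓ {F} upF upG v w w≥k p with ∧⁻ {F v} p
    ... | a , b = ∧⁺ (upF v w w≥k a) (upG v w w≥k b)

    upFrom-⊔ : ∀ {F G : Fam n} → UpFrom k F → UpFrom k G → UpFrom k (F ⊔ G)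
    upFrom-⊔ {F} upF upG v w w≥k p with ∨⁻ {F v} p
    ... | inj₁ a = ∨⁺ˡ (upF v w w≥k a)
    ... | inj₂ b = ∨⁺ʳ {F (v ∪ w)} (upG v w w≥k b)

  -- Since `R` contains `N` and is closed upwards in this coordinate, a lifted set stays inside `R`,
  -- so compressing `N` alone preserves the size of the difference.
  #-difference-sections : ∀ {n} {N R : Fam (suc n)} → lo N ⊑ lo R → lo R ⊑ hi R →
    # (lo R ⊓ ∁ (lo N ⊓ hi N)) + # (hi R ⊓ ∁ (lo N ⊔ hi N)) ≡ # (R ⊓ ∁ N)
  #-difference-sections {N = N} {R} p q = #-additive (λ v → pointwise (lo N v) (hi N v) (lo R v) (hi R v) (p v) (q v))
    where
    pointwise : ∀ a b r s → (T a → T r) → (T r → T s) →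
      ⟦ r ∧ not (a ∧ b) ⟧ + ⟦ s ∧ not (a ∨ b) ⟧ ≡ ⟦ r ∧ not a ⟧ + ⟦ s ∧ not b ⟧
    pointwise false b r s _ _ = refl
    pointwise true b false s h _ with () ← h _
    pointwise true b true false _ h with () ← h _
    pointwise true b true true _ _ = +-comm ⟦ not b ⟧ 0

  -- `R` is the budget for the coordinates below `k`, with `N` itself in the role that `Q` has in
  -- `compression-bound`; the product pays for the remaining coordinates, where Kleitman's
  -- inequality applies in every fibre. `Q` is already closed upwards below `k`, so its sections are
  -- taken as they are, whereas `N` and `P` pass to meet and join.
  product-bound : ∀ {n} k {N P Q R : Fam n} → UnionClosed N → N ⊑ P → N ⊑ Q → N ⊑ R →
    UpFrom k P → UpBelow k Q → UpBelow k R → UnionClosed Q → Fillable k N Q →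
    2 ^ n * wt (∁ N) ≤ 2 ^ n * (g (# ∁ N) + # (R ⊓ ∁ N)) + # P * # ∁ Q
  product-bound {n} zero {N} {P} {Q} {R} ucN N⊑P N⊑Q N⊑R upP upQ upR ucQ fill = begin
    2 ^ n * wt (∁ N)
      ≤⟨ *-monoʳ-≤ (2 ^ n) (compression-bound (λ v w → upP v w (λ _ _ → z≤n)) N⊑P N⊑Q ucQ rel) ⟩
    2 ^ n * (g (# ∁ N) + # (P ⊓ ∁ (compress Q)))
      ≡⟨ *-distribˡ-+ (2 ^ n) (g (# ∁ N)) _ ⟩
    2 ^ n * g (# ∁ N) + 2 ^ n * # (P ⊓ ∁ (compress Q))
      ≤⟨ +-mono-≤ (*-monoʳ-≤ (2 ^ n) (m≤m+n (g (# ∁ N)) (# (R ⊓ ∁ N))))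
                  (kleitman (λ v w → upP v w (λ _ _ → z≤n)) (compress-isUp Q)) ⟩
    2 ^ n * (g (# ∁ N) + # (R ⊓ ∁ N)) + # P * # ∁ (compress Q)
      ≡⟨ cong (λ c → 2 ^ n * (g (# ∁ N) + # (R ⊓ ∁ N)) + # P * c) (#∁-compress Q) ⟩
    2 ^ n * (g (# ∁ N) + # (R ⊓ ∁ N)) + # P * # ∁ Q ∎
    where
    open ≤-Reasoning
    -- No coordinate lies below 0, so the set `D` supplied by `fill` is everything and nothing is
    -- removed from `w`.
    rel : RelUp N Q
    rel v w p q with fill v w p q
    ... | D , allD , r =
      subst (T ∘ N) (cong (v ∪_) (trans (cong (w ∩_) (full D (λ i → allD i z≤n))) (∩-identityʳ w))) r
  product-bound {zero} (suc k) _ _ _ _ _ _ _ _ _ = z≤n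
  product-bound {suc n} (suc k) {N} {P} {Q} {R} ucN N⊑P N⊑Q N⊑R upP upQ upR ucQ fill = begin
    2 * D * wt (∁ N)
      ≡⟨ *-assoc 2 D (wt (∁ N)) ⟩
    2 * (D * wt (∁ N))
      ≤⟨ *-monoʳ-≤ 2 (scaled-section-bound D (wt (∁ N)) (g (# ∁ N)) (g (# ∁ N₀)) (g (# ∁ N₁))
           (wt (∁ N₀)) (wt (∁ N₁)) d (section-step N)
           (product-bound k meet-unionClosed N₀⊑P₀ N₀⊑Q₀ N₀⊑R₀ upP₀
             (upBelow-section false upQ) upR₀ ucQ₀ fill₀)
           (product-bound k join-unionClosed N₁⊑P₁ N₁⊑Q₁ N₁⊑R₁ upP₁
             (upBelow-section true upQ) (upBelow-section true upR) ucQ₁ fill₁)) ⟩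
    2 * (D * (g (# ∁ N) + (r₀ + r₁ + d)) + (# P₀ * # ∁ (lo Q) + # P₁ * # ∁ (hi Q)))
      ≡⟨ distribute D (g (# ∁ N) + (r₀ + r₁ + d)) _ ⟩
    2 * D * (g (# ∁ N) + (r₀ + r₁ + d)) + 2 * (# P₀ * # ∁ (lo Q) + # P₁ * # ∁ (hi Q))
      -- This is why `P` is compressed too: meet and join keep its total size and give `P₀ ⊑ P₁`,
      -- opposite to the shrinking sections of `∁ Q`, so the products over the two fibres merge into
      -- one.
      ≤⟨ +-mono-≤ (*-monoʳ-≤ (2 * D) (+-monoʳ-≤ (g (# ∁ N)) r-bound))
                  (chebyshev (#-mono (⊓⊑⊔ (lo P) (hi P))) (#-mono (∁-anti (upBelow-lo⊑hi upQ)))) ⟩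
    2 * D * (g (# ∁ N) + # (R ⊓ ∁ N)) + (# P₀ + # P₁) * # ∁ Q
      ≡⟨ cong (λ p → 2 * D * (g (# ∁ N) + # (R ⊓ ∁ N)) + p * # ∁ Q)
              (#-additive (λ v → ∧∨-modular (lo P v) (hi P v))) ⟩
    2 * D * (g (# ∁ N) + # (R ⊓ ∁ N)) + # P * # ∁ Q ∎
    where
    open ≤-Reasoning
    open Sections ucN
    D = 2 ^ n
    P₀ = lo P ⊓ hi P
    P₁ = lo P ⊔ hi P
    N₀ = lo N ⊓ hi N
    N₁ = lo N ⊔ hi N
    -- Union-closedness of N keeps up N₀ disjoint from lo N ⊓ ∁ (hi N).
    R₀ = lo R ⊓ up N₀
    r₀ = # (R₀ ⊓ ∁ N₀)
    r₁ = # (hi R ⊓ ∁ N₁)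
    d = # (lo N ⊓ ∁ (hi N))

    distribute : ∀ D a b → 2 * (D * a + b) ≡ 2 * D * a + 2 * b
    distribute = solve-∀

    ∧∨-modular : ∀ a b → ⟦ a ∧ b ⟧ + ⟦ a ∨ b ⟧ ≡ ⟦ a ⟧ + ⟦ b ⟧
    ∧∨-modular true b = +-comm ⟦ b ⟧ 1
    ∧∨-modular false b = refl

    lower : {F : Fam (suc n)} → N ⊑ F → lo N ⊑ lo F
    lower h v = h (false ∷ v)

    upper : {F : Fam (suc n)} → N ⊑ F → hi N ⊑ hi F
    upper h v = h (true ∷ v)

    N₀⊑P₀ : N₀ ⊑ P₀
    N₀⊑P₀ = ⊓-mono (lower N⊑P) (upper N⊑P)
    N₁⊑P₁ : N₁ ⊑ P₁
    N₁⊑P₁ = ⊔-mono (lower N⊑P) (upper N⊑P)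

    N₀⊑lo : {F : Fam (suc n)} → N ⊑ F → N₀ ⊑ lo F
    N₀⊑lo h v p = h (false ∷ v) (proj₁ (∧⁻ {lo N v} p))
    N₁⊑hi : {F : Fam (suc n)} → N ⊑ F → lo F ⊑ hi F → N₁ ⊑ hi F
    N₁⊑hi h lo⊑hi v p with ∨⁻ {lo N v} p
    ... | inj₁ q = lo⊑hi v (h (false ∷ v) q)
    ... | inj₂ q = h (true ∷ v) q

    N₀⊑Q₀ : N₀ ⊑ lo Q
    N₀⊑Q₀ = N₀⊑lo N⊑Q
    N₁⊑Q₁ : N₁ ⊑ hi Q
    N₁⊑Q₁ = N₁⊑hi N⊑Q (upBelow-lo⊑hi upQ)
    N₀⊑R₀ : N₀ ⊑ R₀
    N₀⊑R₀ v p = ∧⁺ (N₀⊑lo N⊑R v p) (up-extensive N₀ v p)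
    N₁⊑R₁ : N₁ ⊑ hi R
    N₁⊑R₁ = N₁⊑hi N⊑R (upBelow-lo⊑hi upR)

    upP₀ : UpFrom k P₀
    upP₀ = upFrom-⊓ {F = lo P} {hi P} (upFrom-section false upP) (upFrom-section true upP)
    upP₁ : UpFrom k P₁
    upP₁ = upFrom-⊔ {F = lo P} {hi P} (upFrom-section false upP) (upFrom-section true upP)

    upR₀ : UpBelow k R₀
    upR₀ v w w<k p with ∧⁻ {lo R v} p
    ... | a , b = ∧⁺ (upBelow-section false upR v w w<k a) (up-isUp N₀ v w b)

    ucQ₀ : UnionClosed (lo Q)
    ucQ₀ v w = ucQ (false ∷ v) (false ∷ w)
    ucQ₁ : UnionClosed (hi Q)
    ucQ₁ v w = ucQ (true ∷ v) (true ∷ w)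

    tail-full : ∀ {b E} → (∀ i → suc k ≤ toℕ i → i ∈ (b ∷ E)) → ∀ i → k ≤ toℕ i → i ∈ E
    tail-full all i k≤i = drop-there (all (Fin.suc i) (s≤s k≤i))

    -- Filling in the lower section gives membership in `lo N` only; uniting the result with
    -- `true ∷ v`, which is also in `N`, gives membership in `hi N`.
    fill₀ : Fillable k N₀ (lo Q)
    fill₀ v w p q with ∧⁻ {lo N v} p
    ... | p₀ , p₁ with fill (false ∷ v) (false ∷ w) p₀ q
    ... | b ∷ E , all , z₀ = E , tail-full all , ∧⁺ z₀
      (subst (T ∘ hi N) (∪-absorb v (w ∩ E)) (ucN (true ∷ v) (false ∷ (v ∪ (w ∩ E))) p₁ z₀))

    -- The current coordinate lies below the threshold, so `D` may drop it. Whether it does decides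
    -- which section of `N` the filled set falls into, and the join accepts both.
    fill₁ : Fillable k N₁ (hi Q)
    fill₁ v w p q with ∨⁻ {lo N v} p
    fill₁ v w p q | inj₁ p₀ with fill (false ∷ v) (true ∷ w) p₀ q
    ... | false ∷ E , all , z = E , tail-full all , ∨⁺ˡ z
    ... | true ∷ E , all , z = E , tail-full all , ∨⁺ʳ {lo N (v ∪ (w ∩ E))} z
    fill₁ v w p q | inj₂ p₁ with fill (true ∷ v) (true ∷ w) p₁ q
    ... | b ∷ E , all , z = E , tail-full all , ∨⁺ʳ {lo N (v ∪ (w ∩ E))} z

    collide : ∀ v → T (lo N v) → T (up N₀ v) → T (hi N v)
    collide v p u with up⁻ N₀ v u
    ... | w , q , e = subst (T ∘ hi N) e (ucN (false ∷ v) (true ∷ w) p (proj₂ (∧⁻ {lo N w} q)))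

    R₀-part : R₀ ⊓ ∁ N₀ ⊑ lo R ⊓ ∁ N₀
    R₀-part = ⊓-mono {F = R₀} (λ v → proj₁ ∘ ∧⁻ {lo R v}) (λ _ q → q)

    N-part : lo N ⊓ ∁ (hi N) ⊑ lo R ⊓ ∁ N₀
    N-part v p with ∧⁻ {lo N v} p
    ... | p₀ , ¬p₁ = ∧⁺ (N⊑R (false ∷ v) p₀) (not⁺ {N₀ v} λ c → not⁻ {hi N v} ¬p₁ (proj₂ (∧⁻ {lo N v} c)))

    disjoint : ∀ v → T ((R₀ ⊓ ∁ N₀) v) → T ((lo N ⊓ ∁ (hi N)) v) → T false
    disjoint v p q with ∧⁻ {lo N v} q
    ... | p₀ , ¬p₁ = not⁻ {hi N v} ¬p₁ (collide v p₀ (proj₂ (∧⁻ {lo R v} (proj₁ (∧⁻ {R₀ v} p)))))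

    r-bound : r₀ + r₁ + d ≤ # (R ⊓ ∁ N)
    r-bound = begin
      r₀ + r₁ + d                        ≡⟨ swap r₀ r₁ d ⟩
      r₀ + d + r₁                        ≤⟨ +-monoˡ-≤ r₁ (#-disjoint R₀-part N-part disjoint) ⟩
      # (lo R ⊓ ∁ N₀) + r₁               ≡⟨ #-difference-sections {N = N} {R} (lower N⊑R) (upBelow-lo⊑hi upR) ⟩
      # (R ⊓ ∁ N)                        ∎
      where
      swap : ∀ a b c → a + b + c ≡ a + c + b
      swap = solve-∀

-- Lists of sets against Boolean families, and the rooted sets of ℬ.

module RootedSets where
  open import Data.Bool using (true; false; T; if_then_else_)
  open import Data.Empty using (⊥-elim)
  open import Data.Fin as Fin using (Fin; toℕ; fromℕ<)
  open import Data.Fin.Properties using (all?; any?; toℕ<n; toℕ-fromℕ<; toℕ-injective)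
  open import Data.Fin.Subset using (Subset; _∈_; _⊆_; _∪_; _∩_; ∣_∣; ⊥)
  open import Data.Fin.Subset.Properties using (_∈?_; _⊆?_; anySubset?; nonempty?; Empty-unique; ∣⊥∣≡0;
    ⊆-trans; p⊆p∪q; q⊆p∪q; x∈p∪q⁻; x∈p∩q⁺; x∈p∩q⁻)
  open import Data.List using ([]; _∷_; _++_; map; length)
  open import Data.List.Membership.Propositional using () renaming (_∈_ to _∈ℓ_; _∉_ to _∉ℓ_)
  open import Data.List.Membership.Propositional.Properties using (∈-++⁺ˡ; ∈-++⁺ʳ; ∈-++⁻; ∈-map⁺; ∈-map⁻; ∈-filter⁺)
  open import Data.List.Properties using (map-++; length-map; length-++)
  open import Data.List.Relation.Unary.All as All using ([]; _∷_)
  open import Data.List.Relation.Unary.AllPairs using ([]; _∷_)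
  open import Data.List.Relation.Unary.Any using (here; there)
  open import Data.List.Relation.Unary.Unique.Propositional using (Unique)
  import Data.List.Relation.Unary.Unique.Propositional.Properties as Unique
  open import Data.Nat hiding (_⊓_; _⊔_)
  open import Data.Nat.ListAction using (sum)
  open import Data.Nat.ListAction.Properties using (sum-++)
  open import Data.Nat.Properties
  open import Data.Nat.Tactic.RingSolver using (solve-∀)
  open import Data.Product using (∃; ∃₂; _×_; _,_; proj₁; proj₂)
  open import Data.Sum using (_⊎_; inj₁; inj₂)
  open import Data.Unit using (tt)
  open import Data.Vec using ([]; _∷_; tabulate)
  open import Data.Vec.Properties using (lookup∘tabulate; []=⇒lookup; lookup⇒[]=; ∷-injectiveʳ)
  open import Function using (_∘_)
  open import Relation.Binary.PropositionalEquality
  open import Relation.Nullary using (Dec; yes; no; ¬_)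
  open import Relation.Nullary.Decidable using (⌊_⌋; toWitness; fromWitness; ¬?; _→-dec_; _×-dec_; decidable-stable)
  open import Relation.Unary using (Decidable)
  open BinaryDigitSums
  open CubeFamilies
  open ColexInitialSegments using (sum-mono-⊆; length-mono-⊆)

  members : ∀ {n} → Fam n → Family n
  members {zero} F = if F [] then [] ∷ [] else []
  members {suc n} F = map (false ∷_) (members (lo F)) ++ map (true ∷_) (members (hi F))

  ∈-members⁺ : ∀ {n} {F : Fam n} v → T (F v) → v ∈ℓ members F
  ∈-members⁺ {zero} {F} [] f with F []
  ... | true = here refl
  ∈-members⁺ {suc n} (false ∷ v) f = ∈-++⁺ˡ (∈-map⁺ (false ∷_) (∈-members⁺ v f))
  ∈-members⁺ {suc n} {F} (true ∷ v) f = ∈-++⁺ʳ (map (false ∷_) (members (lo F))) (∈-map⁺ (true ∷_) (∈-members⁺ v f))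

  ∈-members⁻ : ∀ {n} {F : Fam n} v → v ∈ℓ members F → T (F v)
  ∈-members⁻ {zero} {F} [] v∈ with F []
  ... | true = tt
  ... | false with () ← v∈
  ∈-members⁻ {suc n} {F} v v∈ with ∈-++⁻ (map (false ∷_) (members (lo F))) v∈
  ... | inj₁ p with ∈-map⁻ (false ∷_) p
  ...   | w , w∈ , refl = ∈-members⁻ w w∈
  ∈-members⁻ {suc n} {F} v v∈ | inj₂ p with ∈-map⁻ (true ∷_) p
  ...   | w , w∈ , refl = ∈-members⁻ w w∈

  members-unique : ∀ {n} (F : Fam n) → Unique (members F)
  members-unique {zero} F with F []
  ... | true = [] ∷ []
  ... | false = []
  members-unique {suc n} F =
    Unique.++⁺ (Unique.map⁺ ∷-injectiveʳ (members-unique (lo F))) (Unique.map⁺ ∷-injectiveʳ (members-unique (hi F))) disjoint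
    where
    disjoint : ∀ {v} → v ∈ℓ map (false ∷_) (members (lo F)) × v ∈ℓ map (true ∷_) (members (hi F)) → Data.Empty.⊥
    disjoint (p , q) with ∈-map⁻ (false ∷_) p | ∈-map⁻ (true ∷_) q
    ... | _ , _ , refl | _ , _ , ()

  length-members : ∀ {n} (F : Fam n) → length (members F) ≡ # F
  length-members {zero} F with F []
  ... | true = refl
  ... | false = refl
  length-members {suc n} F = begin
    length (map (false ∷_) (members (lo F)) ++ map (true ∷_) (members (hi F)))
      ≡⟨ length-++ (map (false ∷_) (members (lo F))) ⟩
    length (map (false ∷_) (members (lo F))) + length (map (true ∷_) (members (hi F)))
      ≡⟨ cong₂ _+_ (length-map (false ∷_) (members (lo F))) (length-map (true ∷_) (members (hi F))) ⟩
    length (members (lo F)) + length (members (hi F))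
      ≡⟨ cong₂ _+_ (length-members (lo F)) (length-members (hi F)) ⟩
    # F ∎
    where open ≡-Reasoning

  weight-++ : ∀ {n} (𝒜 ℬ : Family n) → weight (𝒜 ++ ℬ) ≡ weight 𝒜 + weight ℬ
  weight-++ 𝒜 ℬ = trans (cong sum (map-++ ∣_∣ 𝒜 ℬ)) (sum-++ (map ∣_∣ 𝒜) (map ∣_∣ ℬ))

  weight-outside : ∀ {n} (ℬ : Family n) → weight (map (false ∷_) ℬ) ≡ weight ℬ
  weight-outside [] = refl
  weight-outside (B ∷ ℬ) = cong (∣ B ∣ +_) (weight-outside ℬ)

  weight-inside : ∀ {n} (ℬ : Family n) → weight (map (true ∷_) ℬ) ≡ weight ℬ + length ℬ
  weight-inside [] = refl
  weight-inside (B ∷ ℬ) rewrite weight-inside ℬ = rearrange ∣ B ∣ (weight ℬ) (length ℬ)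
    where
    rearrange : ∀ a b c → suc a + (b + c) ≡ a + b + suc c
    rearrange = solve-∀

  weight-members : ∀ {n} (F : Fam n) → weight (members F) ≡ wt F
  weight-members {zero} F with F []
  ... | true = refl
  ... | false = refl
  weight-members {suc n} F = begin
    weight (map (false ∷_) (members (lo F)) ++ map (true ∷_) (members (hi F)))
      ≡⟨ weight-++ (map (false ∷_) (members (lo F))) _ ⟩
    weight (map (false ∷_) (members (lo F))) + weight (map (true ∷_) (members (hi F)))
      ≡⟨ cong₂ _+_ (weight-outside (members (lo F))) (weight-inside (members (hi F))) ⟩
    weight (members (lo F)) + (weight (members (hi F)) + length (members (hi F)))
      ≡⟨ cong₂ _+_ (weight-members (lo F)) (cong₂ _+_ (weight-members (hi F)) (length-members (hi F))) ⟩
    wt (lo F) + (wt (hi F) + # hi F)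
      ≡⟨ +-assoc (wt (lo F)) _ _ ⟨
    wt F ∎
    where open ≡-Reasoning

  #∁-⊓ : ∀ {n} (F G : Fam n) → # ∁ (F ⊓ G) ≤ # ∁ F + # ∁ G
  #∁-⊓ F G = ≤-trans (m≤m+n _ (# ∁ (F ⊔ G))) (≤-reflexive (#-additive (λ v → modular (F v) (G v))))

  #-∁ : ∀ {n} (F : Fam n) → # F + # ∁ F ≡ 2 ^ n
  #-∁ {zero} F with F []
  ... | true = refl
  ... | false = refl
  #-∁ {suc n} F = begin
    (# lo F + # hi F) + (# ∁ (lo F) + # ∁ (hi F)) ≡⟨ rearrange (# lo F) _ _ _ ⟩
    (# lo F + # ∁ (lo F)) + (# hi F + # ∁ (hi F)) ≡⟨ cong₂ _+_ (#-∁ (lo F)) (#-∁ (hi F)) ⟩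
    2 ^ n + 2 ^ n                                 ≡⟨ cong (2 ^ n +_) (+-identityʳ (2 ^ n)) ⟨
    2 ^ suc n                                     ∎
    where
    open ≡-Reasoning
    rearrange : ∀ a b c d → (a + b) + (c + d) ≡ (a + c) + (b + d)
    rearrange = solve-∀

  -- The inequality (m - b)² ≤ s² with its subtractions moved across.
  square-gap : ∀ {m b s} → m ≤ b + s → b ≤ m + s → m * m + b * b ≤ 2 * (b * m) + s * s
  square-gap {m} {b} {s} h h′ with ≤-total m b
  ... | inj₁ m≤b with m≤n⇒∃[o]m+o≡n m≤b
  ...   | t , refl = begin
    m * m + (m + t) * (m + t)   ≡⟨ expand m t ⟩
    2 * ((m + t) * m) + t * t   ≤⟨ +-monoʳ-≤ (2 * ((m + t) * m)) (*-mono-≤ t≤s t≤s) ⟩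
    2 * ((m + t) * m) + s * s   ∎
    where
    open ≤-Reasoning
    t≤s = +-cancelˡ-≤ m _ _ h′
    expand : ∀ m t → m * m + (m + t) * (m + t) ≡ 2 * ((m + t) * m) + t * t
    expand = solve-∀
  square-gap {m} {b} {s} h h′ | inj₂ b≤m with m≤n⇒∃[o]m+o≡n b≤m
  ...   | t , refl = begin
    (b + t) * (b + t) + b * b   ≡⟨ expand b t ⟩
    2 * (b * (b + t)) + t * t   ≤⟨ +-monoʳ-≤ (2 * (b * (b + t))) (*-mono-≤ t≤s t≤s) ⟩
    2 * (b * (b + t)) + s * s   ∎
    where
    open ≤-Reasoning
    t≤s = +-cancelˡ-≤ b _ _ h
    expand : ∀ b t → (b + t) * (b + t) + b * b ≡ 2 * (b * (b + t)) + t * t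
    expand = solve-∀

  crossing : ∀ (a : ℕ → ℕ) m n → m ≤ 2 * a n → m ≤ 2 * a 0 ⊎ ∃ λ k → k < n × 2 * a k < m × m ≤ 2 * a (suc k)
  crossing a m zero h = inj₁ h
  crossing a m (suc n) h with m ≤? 2 * a n
  ... | no m≰ = inj₂ (n , ≤-refl , ≰⇒> m≰ , h)
  ... | yes h′ with crossing a m n h′
  ...   | inj₁ z = inj₁ z
  ...   | inj₂ (k , k<n , rest) = inj₂ (k , m<n⇒m<1+n k<n , rest)

  -- The interval of `C` is part of the interval of `B`. This heredity makes the unrooted families
  -- union-closed: a root of a union is a root of whichever part contains it.
  rooted-⊆ : ∀ {n} {ℬ : Family n} {i B C} → RootedAt ℬ i B → i ∈ C → C ⊆ B → RootedAt ℬ i C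
  rooted-⊆ (_ , h) i∈C C⊆B = i∈C , λ D i∈D D⊆C → h D i∈D (⊆-trans D⊆C C⊆B)

  rooted⇒∈ : ∀ {n} {ℬ : Family n} {i B} → RootedAt ℬ i B → B ∈ℓ ℬ
  rooted⇒∈ (i∈B , h) = h _ i∈B (λ x∈ → x∈)

  module Unrooted {n} (ℬ : Family n) where

    unrooted : {S : Fin n → Set} → Decidable S → Fam n
    unrooted S? v = ⌊ all? (λ i → S? i →-dec ¬? (rootedAt? ℬ i v)) ⌋

    module _ {S : Fin n → Set} (S? : Decidable S) where

      unrooted⁺ : ∀ v → (∀ i → S i → ¬ RootedAt ℬ i v) → T (unrooted S? v)
      unrooted⁺ v h = fromWitness {a? = all? (λ i → S? i →-dec ¬? (rootedAt? ℬ i v))} h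

      unrooted⁻ : ∀ v → T (unrooted S? v) → ∀ i → S i → ¬ RootedAt ℬ i v
      unrooted⁻ v h = toWitness {a? = all? (λ i → S? i →-dec ¬? (rootedAt? ℬ i v))} h

      unrooted-unionClosed : UnionClosed (unrooted S?)
      unrooted-unionClosed v w p q = unrooted⁺ (v ∪ w) λ i i∈S r →
        split i i∈S r (x∈p∪q⁻ v w (proj₁ r))
        where
        split : ∀ i → S i → RootedAt ℬ i (v ∪ w) → i ∈ v ⊎ i ∈ w → Data.Empty.⊥
        split i i∈S r (inj₁ i∈v) = unrooted⁻ v p i i∈S (rooted-⊆ r i∈v (p⊆p∪q w))
        split i i∈S r (inj₂ i∈w) = unrooted⁻ w q i i∈S (rooted-⊆ r i∈w (q⊆p∪q v w))

      unrooted-up : ∀ v w → (∀ i → i ∈ w → ¬ S i) → T (unrooted S? v) → T (unrooted S? (v ∪ w))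
      unrooted-up v w outside p = unrooted⁺ (v ∪ w) λ i i∈S r →
        split i i∈S r (x∈p∪q⁻ v w (proj₁ r))
        where
        split : ∀ i → S i → RootedAt ℬ i (v ∪ w) → i ∈ v ⊎ i ∈ w → Data.Empty.⊥
        split i i∈S r (inj₁ i∈v) = unrooted⁻ v p i i∈S (rooted-⊆ r i∈v (p⊆p∪q w))
        split i i∈S r (inj₂ i∈w) = outside i i∈w i∈S

      rooted-exists : ∀ v → T (∁ (unrooted S?) v) → ∃ λ i → S i × RootedAt ℬ i v
      rooted-exists v h with any? (λ i → S? i ×-dec rootedAt? ℬ i v)
      ... | yes p = p
      ... | no ¬p = ⊥-elim (not⁻ {unrooted S? v} h (unrooted⁺ v (λ i i∈S r → ¬p (i , i∈S , r))))

      rooted⇒∁ : ∀ {i} v → S i → RootedAt ℬ i v → T (∁ (unrooted S?) v)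
      rooted⇒∁ {i} v i∈S r = not⁺ {unrooted S? v} (λ u → ⊥-elim (unrooted⁻ v u i i∈S r))

    below? : ∀ k → Decidable (λ (i : Fin n) → toℕ i < k)
    below? k i = toℕ i <? k

    above? : ∀ k → Decidable (λ (i : Fin n) → k ≤ toℕ i)
    above? k i = k ≤? toℕ i

    below above : ℕ → Fam n
    below k = unrooted (below? k)
    above k = unrooted (above? k)

    -- The same sets for every `k`; the index only records the splitting, so that the inclusions in
    -- `below k` and `above k` are projections.
    neverRooted : ℕ → Fam n
    neverRooted k = below k ⊓ above k

    neverRooted⁻ : ∀ k v → T (neverRooted k v) → ∀ i → ¬ RootedAt ℬ i v
    neverRooted⁻ k v p i with ∧⁻ {below k v} p | toℕ i <? k
    ... | b , _ | yes i<k = unrooted⁻ (below? k) v b i i<k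
    ... | _ , a | no i≮k = unrooted⁻ (above? k) v a i (≮⇒≥ i≮k)

    neverRooted⁺ : ∀ k v → (∀ i → ¬ RootedAt ℬ i v) → T (neverRooted k v)
    neverRooted⁺ k v h = ∧⁺ (unrooted⁺ (below? k) v (λ i _ → h i)) (unrooted⁺ (above? k) v (λ i _ → h i))

    obstruction : ∀ {i B} → i ∈ B → ¬ RootedAt ℬ i B → ∃ λ C → i ∈ C × C ⊆ B × C ∉ℓ ℬ
    obstruction {i} {B} i∈B ¬r with anySubset? (λ C → (i ∈? C) ×-dec ((C ⊆? B) ×-dec ¬? (C ∈ℬ? ℬ)))
    ... | yes p = p
    ... | no ¬p = ⊥-elim (¬r (i∈B , λ C i∈C C⊆B → decidable-stable (C ∈ℬ? ℬ)
            (λ C∉ → ¬p (C , i∈C , (λ {x} → C⊆B {x}) , C∉))))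

    -- The elements of `w` at which `v ∪ w` is rooted are dropped. Any other element i has a witness
    -- C outside ℬ with i ∈ C ⊆ v ∪ w, and the same C shows that `v ∪ w` is rooted at none of its
    -- elements. So C survives the dropping and still prevents i from being a root.
    fillable : ∀ k → Fillable k (neverRooted k) (above k)
    fillable k v w p q = D , D-full , neverRooted⁺ k Z λ i r → unrootable i r
      where
      keep? : ∀ i → Dec (¬ RootedAt ℬ i (v ∪ w))
      keep? i = ¬? (rootedAt? ℬ i (v ∪ w))
      D : Subset n
      D = tabulate (λ i → ⌊ keep? i ⌋)
      -- Z is the union of the subsets of v ∪ w that lie outside ℬ.
      Z = v ∪ (w ∩ D)
      ∈D⁺ : ∀ {i} → ¬ RootedAt ℬ i (v ∪ w) → i ∈ D
      ∈D⁺ {i} h = lookup⇒[]= i D (trans (lookup∘tabulate _ i) (T-true (fromWitness {a? = keep? i} h)))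
        where
        T-true : ∀ {b} → T b → b ≡ true
        T-true {true} _ = refl
      ∈D⁻ : ∀ {i} → i ∈ D → ¬ RootedAt ℬ i (v ∪ w)
      ∈D⁻ {i} h = toWitness {a? = keep? i} (subst T (trans (sym ([]=⇒lookup h)) (lookup∘tabulate _ i)) tt)
      D-full : ∀ i → k ≤ toℕ i → i ∈ D
      D-full i k≤i = ∈D⁺ (unrooted⁻ (above? k) (v ∪ w) q i k≤i)
      Z⊆ : Z ⊆ v ∪ w
      Z⊆ x∈ with x∈p∪q⁻ v (w ∩ D) x∈
      ... | inj₁ x∈v = p⊆p∪q w x∈v
      ... | inj₂ x∈wD = q⊆p∪q v w (proj₁ (x∈p∩q⁻ w D x∈wD))
      ∈Z⁻ : ∀ {i} → i ∈ Z → ¬ RootedAt ℬ i (v ∪ w)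
      ∈Z⁻ {i} i∈Z r with x∈p∪q⁻ v (w ∩ D) i∈Z
      ... | inj₁ i∈v = neverRooted⁻ k v p i (rooted-⊆ r i∈v (p⊆p∪q w))
      ... | inj₂ i∈wD = ∈D⁻ (proj₂ (x∈p∩q⁻ w D i∈wD)) r
      unrootable : ∀ i → ¬ RootedAt ℬ i Z
      unrootable i r@(i∈Z , all) with obstruction (Z⊆ i∈Z) (∈Z⁻ i∈Z)
      ... | C , i∈C , C⊆ , C∉ = C∉ (all C i∈C C⊆Z)
        where
        C⊆Z : C ⊆ Z
        C⊆Z {j} j∈C with x∈p∪q⁻ v w (C⊆ j∈C)
        ... | inj₁ j∈v = p⊆p∪q (w ∩ D) j∈v
        ... | inj₂ j∈w = q⊆p∪q v (w ∩ D) (x∈p∩q⁺ (j∈w , ∈D⁺ (λ r′ → C∉ (proj₂ r′ C j∈C C⊆))))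

    -- `above k` serves both as `Q` and as the budget `R`. Adding `a * c` completes the product
    -- `# below k * c` to `2 ^ n * c`, so the two charges together stay within the sets outside `N`.
    split-bound : ∀ k → 2 ^ n * wt (∁ (neverRooted k)) + # ∁ (below k) * # ∁ (above k) ≤
                        2 ^ n * (g (# ∁ (neverRooted k)) + # ∁ (neverRooted k))
    split-bound k = begin
      E * wt (∁ N) + a * c
        ≤⟨ +-monoˡ-≤ (a * c) (product-bound k ucN N⊑P N⊑Q N⊑Q
             (λ v w h → unrooted-up (below? k) v w (λ i i∈w i<k → <-irrefl refl (<-≤-trans i<k (h i i∈w))))
             upQ upQ (unrooted-unionClosed (above? k)) (fillable k)) ⟩
      E * (g (# ∁ N) + x) + # below k * c + a * c
        ≡⟨ rearrange (E * (g (# ∁ N) + x)) (# below k) a c ⟩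
      E * (g (# ∁ N) + x) + (# below k + a) * c
        ≡⟨ cong (λ z → E * (g (# ∁ N) + x) + z * c) (#-∁ (below k)) ⟩
      E * (g (# ∁ N) + x) + E * c
        ≡⟨ factor E (g (# ∁ N)) x c ⟩
      E * (g (# ∁ N) + (x + c))
        ≤⟨ *-monoʳ-≤ E (+-monoʳ-≤ (g (# ∁ N)) (#-disjoint (λ v → proj₂ ∘ ∧⁻ {above k v}) (∁-anti N⊑Q)
             (λ v p q → not⁻ {above k v} q (proj₁ (∧⁻ {above k v} p))))) ⟩
      E * (g (# ∁ N) + # ∁ N) ∎
      where
      open ≤-Reasoning
      E = 2 ^ n
      N = neverRooted k
      a = # ∁ (below k)
      c = # ∁ (above k)
      x = # (above k ⊓ ∁ N)
      N⊑P : N ⊑ below k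
      N⊑P v = proj₁ ∘ ∧⁻ {below k v}
      N⊑Q : N ⊑ above k
      N⊑Q v = proj₂ ∘ ∧⁻ {below k v}
      ucN : UnionClosed N
      ucN v w p q with ∧⁻ {below k v} p | ∧⁻ {below k w} q
      ... | p₁ , p₂ | q₁ , q₂ = ∧⁺ (unrooted-unionClosed (below? k) v w p₁ q₁) (unrooted-unionClosed (above? k) v w p₂ q₂)
      upQ : UpBelow k (above k)
      upQ v w h = unrooted-up (above? k) v w (λ i i∈w k≤i → <-irrefl refl (<-≤-trans (h i i∈w) k≤i))
      rearrange : ∀ z p a c → z + p * c + a * c ≡ z + (p + a) * c
      rearrange = solve-∀
      factor : ∀ E g x c → E * (g + x) + E * c ≡ E * (g + (x + c))
      factor = solve-∀

  g-mono : ∀ {m n} → m ≤ n → g m ≤ g n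
  g-mono {n = zero} z≤n = z≤n
  g-mono {m} {suc n} h with m≤n⇒m<n∨m≡n h
  ... | inj₁ (s≤s h′) = ≤-trans (g-mono h′) (m≤m+n (g n) _)
  ... | inj₂ refl = ≤-refl

  scaled-bound : ∀ E w W a c m m′ e s → m ≡ m′ + e → w ≤ W →
           E * W + a * c ≤ E * (g m′ + m′) →
           m * m ≤ 4 * (a * c) + 4 * (E * e) + s * s →
           8 * E * w + m * m ≤ 8 * E * (g m + m) + s * s
  scaled-bound E w W a c m m′ e s refl w≤W bound square = begin
    8 * E * w + m * m
      ≤⟨ +-mono-≤ (*-monoʳ-≤ (8 * E) w≤W) square ⟩
    8 * E * W + (4 * (a * c) + 4 * (E * e) + s * s)
      -- Doubling these terms only serves to reach the factor 8 of the claim; undoubled, the same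
      -- computation goes through with 4, that is, with 1/4 in place of 1/8.
      ≤⟨ m≤m+n _ (4 * (a * c) + 4 * (E * e)) ⟩
    8 * E * W + (4 * (a * c) + 4 * (E * e) + s * s) + (4 * (a * c) + 4 * (E * e))
      ≡⟨ collect E W (a * c) e (s * s) ⟩
    8 * (E * W + a * c) + (8 * (E * e) + s * s)
      ≤⟨ +-monoˡ-≤ _ (*-monoʳ-≤ 8 (≤-trans bound (*-monoʳ-≤ E (+-monoˡ-≤ m′ (g-mono (m≤m+n m′ e)))))) ⟩
    8 * (E * (g m + m′)) + (8 * (E * e) + s * s)
      ≡⟨ expand E (g m) m′ e (s * s) ⟩
    8 * E * (g m + m) + s * s ∎
    where
    open ≤-Reasoning
    collect : ∀ E W x e z → 8 * E * W + (4 * x + 4 * (E * e) + z) + (4 * x + 4 * (E * e)) ≡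
              8 * (E * W + x) + (8 * (E * e) + z)
    collect = solve-∀
    expand : ∀ E g m e z → 8 * (E * (g + m)) + (8 * (E * e) + z) ≡ 8 * E * (g + (m + e)) + z
    expand = solve-∀

  -- Expand (m - 2a)² ≤ s² and replace m by a + c + e in the mixed term 4 a m. Besides 4 a c this
  -- leaves 4 a e, which is enlarged to 4 E e to match the surplus that the deficit e creates
  -- elsewhere.
  balanced : ∀ E a c m e s → m ≤ 2 * a + s → 2 * a ≤ m + s → m ≤ a + c + e → a ≤ E →
             m * m ≤ 4 * (a * c) + 4 * (E * e) + s * s
  balanced E a c m e s h h′ m≤ a≤E = +-cancelʳ-≤ (2 * a * (2 * a)) _ _ (begin
    m * m + 2 * a * (2 * a)                                 ≤⟨ square-gap h h′ ⟩
    2 * (2 * a * m) + s * s                                 ≤⟨ +-monoˡ-≤ (s * s) (*-monoʳ-≤ 2 (*-monoʳ-≤ (2 * a) m≤)) ⟩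
    2 * (2 * a * (a + c + e)) + s * s                       ≡⟨ expand a c e s ⟩
    4 * (a * c) + 4 * (a * e) + s * s + 2 * a * (2 * a)
      ≤⟨ +-monoˡ-≤ _ (+-monoˡ-≤ (s * s) (+-monoʳ-≤ (4 * (a * c)) (*-monoʳ-≤ 4 (*-monoˡ-≤ e a≤E)))) ⟩
    4 * (a * c) + 4 * (E * e) + s * s + 2 * a * (2 * a)     ∎)
    where
    open ≤-Reasoning
    expand : ∀ a c e s → 2 * (2 * a * (a + c + e)) + s * s ≡ 4 * (a * c) + 4 * (a * e) + s * s + 2 * a * (2 * a)
    expand = solve-∀

  -- The interval from 2a to 2a′ has length at most 2s, so one of its ends is within s of m.
  nearest : ∀ m a a′ s → 2 * a ≤ m → m ≤ 2 * a′ → a′ ≤ a + s → m ≤ 2 * a + s ⊎ 2 * a′ ≤ m + s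
  nearest m a a′ s h h′ step with m ≤? 2 * a + s
  ... | yes p = inj₁ p
  ... | no ¬p = inj₂ (begin
    2 * a′           ≤⟨ *-monoʳ-≤ 2 step ⟩
    2 * (a + s)      ≡⟨ expand a s ⟩
    2 * a + s + s    ≤⟨ +-monoˡ-≤ s (<⇒≤ (≰⇒> ¬p)) ⟩
    m + s            ∎)
    where
    open ≤-Reasoning
    expand : ∀ a s → 2 * (a + s) ≡ 2 * a + s + s
    expand = solve-∀

  -- The choice of a balanced threshold.

  module Threshold {n} (E m : ℕ) (a c m′ : ℕ → ℕ) (s : Fin n → ℕ)
    (E>0 : 0 < E) (a≤E : ∀ k → a k ≤ E) (a-zero : a 0 ≡ 0)
    (a-step : ∀ k (k<n : k < n) → a (suc k) ≤ a k + s (fromℕ< k<n))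
    (m′≤m : ∀ k → m′ k ≤ m) (m≤1+m′ : ∀ k → m ≤ suc (m′ k))
    (m′≤a+c : ∀ k → m′ k ≤ a k + c k) (m′≤a : m′ n ≤ a n) where

    deficit : ∀ k → m ≡ m′ k + (m ∸ m′ k)
    deficit k = sym (m+[n∸m]≡n (m′≤m k))

    near⇒square : ∀ k t → m ≤ 2 * a k + t → 2 * a k ≤ m + t →
      m * m ≤ 4 * (a k * c k) + 4 * (E * (m ∸ m′ k)) + t * t
    near⇒square k t h h′ = balanced E (a k) (c k) m (m ∸ m′ k) t h h′
      (≤-trans (≤-reflexive (deficit k)) (+-monoˡ-≤ (m ∸ m′ k) (m′≤a+c k))) (a≤E k)

    choice : 1 ≤ n → ∃₂ λ k i → m * m ≤ 4 * (a k * c k) + 4 * (E * (m ∸ m′ k)) + s i * s i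
    choice (s≤s _) with m ≤? 2 * a n
    -- Every rooted set is rooted below `n`, so this happens only if there are none. Then m ≤ 1, the
    -- deficit is all of m and pays alone; the index is arbitrary.
    ... | no m≰ = n , Fin.zero , ≤-trans tiny (≤-trans (m≤n+m _ (4 * (a n * c n))) (m≤m+n _ _))
      where
      m′≡0 : m′ n ≡ 0
      m′≡0 = n<1⇒n≡0 (+-cancelʳ-< (m′ n) (m′ n) 1 (begin-strict
        m′ n + m′ n  ≡⟨ cong (m′ n +_) (+-identityʳ (m′ n)) ⟨
        2 * m′ n     ≤⟨ *-monoʳ-≤ 2 m′≤a ⟩
        2 * a n      <⟨ ≰⇒> m≰ ⟩
        m            ≤⟨ m≤1+m′ n ⟩
        1 + m′ n     ∎))
        where open ≤-Reasoning
      m≤1 : m ≤ 1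
      m≤1 = subst (λ z → m ≤ suc z) m′≡0 (m≤1+m′ n)
      tiny : m * m ≤ 4 * (E * (m ∸ m′ n))
      tiny = begin
        m * m                   ≤⟨ *-monoˡ-≤ m m≤1 ⟩
        1 * m                   ≤⟨ *-monoˡ-≤ m E>0 ⟩
        E * m                   ≡⟨ cong (λ z → E * (m ∸ z)) m′≡0 ⟨
        E * (m ∸ m′ n)          ≤⟨ m≤n*m _ 4 ⟩
        4 * (E * (m ∸ m′ n))    ∎
        where open ≤-Reasoning
    ... | yes h with crossing a m n h
    -- As `a 0` vanishes, m is 0 here, and again any index will do.
    ...   | inj₁ m≤0 = 0 , Fin.zero , near⇒square 0 (s Fin.zero) (m≤n⇒m≤n+o _ m≤0)
              (≤-trans (≤-reflexive (cong (2 *_) a-zero)) z≤n)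
    ...   | inj₂ (k , k<n , lower , upper) with nearest m (a k) (a (suc k)) (s (fromℕ< k<n)) (<⇒≤ lower) upper (a-step k k<n)
    ...     | inj₁ near = k , fromℕ< k<n , near⇒square k (s (fromℕ< k<n)) near (m≤n⇒m≤n+o _ (<⇒≤ lower))
    ...     | inj₂ near = suc k , fromℕ< k<n , near⇒square (suc k) (s (fromℕ< k<n)) (m≤n⇒m≤n+o _ upper) near

  module _ {n} (ℬ : Family n) (unique : Unique ℬ) (simplyRooted : SimplyRooted ℬ) where
    open Unrooted ℬ

    private
      m = length ℬ
      E = 2 ^ n
      a c m′ : ℕ → ℕ
      a k = # ∁ (below k)
      c k = # ∁ (above k)
      m′ k = # ∁ (neverRooted k)
      s : Fin n → ℕ
      s i = length (rootedFamily ℬ i)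

    everRooted : ∀ k v → T (∁ (neverRooted k) v) → ∃ λ i → RootedAt ℬ i v
    everRooted k v h with any? (λ i → rootedAt? ℬ i v)
    ... | yes p = p
    ... | no ¬p = ⊥-elim (not⁻ {neverRooted k v} h (neverRooted⁺ k v (λ i r → ¬p (i , r))))

    rooted⇒∁never : ∀ k {i} v → RootedAt ℬ i v → T (∁ (neverRooted k) v)
    rooted⇒∁never k {i} v r = not⁺ {neverRooted k v} (λ u → ⊥-elim (neverRooted⁻ k v u i r))

    m′≤m : ∀ k → m′ k ≤ m
    m′≤m k = subst (_≤ m) (length-members (∁ (neverRooted k)))
      (length-mono-⊆ (members-unique (∁ (neverRooted k))) λ {v} v∈ → rooted⇒∈ (proj₂ (everRooted k v (∈-members⁻ v v∈))))

    -- The empty set has no element to be rooted at, yet may belong to ℬ; adding it by hand costs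
    -- one in the size and nothing in the weight.
    ℬ⊆ : ∀ k {v} → v ∈ℓ ℬ → v ∈ℓ ⊥ ∷ members (∁ (neverRooted k))
    ℬ⊆ k {v} v∈ℬ with nonempty? v
    ... | no empty = here (Empty-unique empty)
    ... | yes nonempty = there (∈-members⁺ v (rooted⇒∁never k v (proj₂ (simplyRooted v v∈ℬ nonempty))))

    m≤1+m′ : ∀ k → m ≤ suc (m′ k)
    m≤1+m′ k = subst (λ l → m ≤ suc l) (length-members (∁ (neverRooted k))) (length-mono-⊆ unique (ℬ⊆ k))

    weight≤ : ∀ k → weight ℬ ≤ wt (∁ (neverRooted k))
    weight≤ k = ≤-trans (sum-mono-⊆ ∣_∣ unique (ℬ⊆ k))
      (≤-reflexive (cong₂ _+_ (∣⊥∣≡0 n) (weight-members (∁ (neverRooted k)))))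

    -- A set rooted below k + 1 but not below k is rooted at k. The double complement of `R` lets
    -- `#∁-⊓` act as the union bound.
    a-step : ∀ k (k<n : k < n) → a (suc k) ≤ a k + s (fromℕ< k<n)
    a-step k k<n = begin
      # ∁ (below (suc k))                    ≤⟨ #-mono step ⟩
      # ∁ (below k ⊓ ∁ R)                    ≤⟨ #∁-⊓ (below k) (∁ R) ⟩
      a k + # ∁ (∁ R)                        ≤⟨ +-monoʳ-≤ (a k) R≤ ⟩
      a k + s i                              ∎
      where
      open ≤-Reasoning
      i = fromℕ< k<n
      R : Fam n
      R v = ⌊ rootedAt? ℬ i v ⌋
      R⁻ : ∀ v → T (∁ (∁ R) v) → RootedAt ℬ i v
      R⁻ v h with rootedAt? ℬ i v
      ... | yes r = r
      step : ∁ (below (suc k)) ⊑ ∁ (below k ⊓ ∁ R)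
      step v h with rooted-exists (below? (suc k)) v h
      ... | j , j<1+k , r with m≤n⇒m<n∨m≡n (s≤s⁻¹ j<1+k)
      ...   | inj₁ j<k = not⁺ {(below k ⊓ ∁ R) v} λ u → ⊥-elim (unrooted⁻ (below? k) v (proj₁ (∧⁻ {below k v} u)) j j<k r)
      ...   | inj₂ j≡k = not⁺ {(below k ⊓ ∁ R) v} λ u → not⁻ {R v} (proj₂ (∧⁻ {below k v} u))
                (fromWitness {a? = rootedAt? ℬ i v}
                  (subst (λ l → RootedAt ℬ l v) (toℕ-injective (trans j≡k (sym (toℕ-fromℕ< k<n)))) r))
      R≤ : # ∁ (∁ R) ≤ s i
      R≤ = subst (_≤ s i) (length-members (∁ (∁ R)))
        (length-mono-⊆ (members-unique (∁ (∁ R))) λ {v} v∈ →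
          let r = R⁻ v (∈-members⁻ v v∈) in ∈-filter⁺ (rootedAt? ℬ i) (rooted⇒∈ r) r)

    a-zero : a 0 ≡ 0
    a-zero = n≤0⇒n≡0 (≤-trans (#-mono none) (≤-reflexive (#-∅ n)))
      where
      none : ∁ (below 0) ⊑ (λ _ → false)
      none v h with rooted-exists (below? 0) v h
      ... | _ , () , _

    m′≤a : m′ n ≤ a n
    m′≤a = #-mono λ v h → let i , r = everRooted n v h in rooted⇒∁ (below? n) v (toℕ<n i) r

    a≤E : ∀ k → a k ≤ E
    a≤E k = subst (a k ≤_) (#-∁ (below k)) (m≤n+m (a k) (# below k))

    open Threshold E m a c m′ s (m^n>0 2 n) a≤E a-zero a-step m′≤m m≤1+m′
      (λ k → #∁-⊓ (below k) (above k)) m′≤a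

    weight-bound : 1 ≤ n → ∃ λ i → 8 * E * weight ℬ + m * m ≤ 8 * E * (g m + m) + s i * s i
    weight-bound 1≤n =
      let k , i , square = choice 1≤n in i ,
      scaled-bound E (weight ℬ) (wt (∁ (neverRooted k))) (a k) (c k) m (m′ k) (m ∸ m′ k) (s i)
        (deficit k) (weight≤ k) (split-bound k) square

-- From natural numbers to rationals.

module Denominators where
  open import Data.Integer as ℤ using (+_)
  import Data.Integer.Properties as ℤ
  open import Data.Nat as ℕ using (ℕ; suc)
  import Data.Nat.Properties as ℕ
  open import Data.Rational as ℚ using (ℚ; _/_; 0ℚ; 1ℚ; _+_; _-_; _≤_; _*_; toℚᵘ; NonNegative)
  open import Data.Rational.Properties
  open import Data.Rational.Solver
  import Data.Rational.Unnormalised as ℚᵘ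
  import Data.Rational.Unnormalised.Properties as ℚᵘ
  open import Relation.Binary.PropositionalEquality

  infix 8 ι_
  ι_ : ℕ → ℚ
  ι n = + n / 1

  -- `_/_` reduces to lowest terms and so does not compute on variables; identities are checked
  -- among unnormalised fractions, where equality is cross-multiplication.
  toℚᵘ-/ : ∀ n d .{{_ : ℕ.NonZero d}} → toℚᵘ (n / d) ℚᵘ.≃ (n ℚᵘ./ d)
  toℚᵘ-/ n (suc d) = toℚᵘ-fromℚᵘ (ℚᵘ.mkℚᵘ n d)

  ι-+ : ∀ a b → ι (a ℕ.+ b) ≡ ι a + ι b
  ι-+ a b = toℚᵘ-injective (begin-equality
    toℚᵘ (ι (a ℕ.+ b))             ≃⟨ toℚᵘ-/ (+ (a ℕ.+ b)) 1 ⟩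
    + (a ℕ.+ b) ℚᵘ./ 1              ≡⟨ cong (ℚᵘ._/ 1) (trans (ℤ.pos-+ a b)
                                       (sym (cong₂ ℤ._+_ (ℤ.*-identityʳ (+ a)) (ℤ.*-identityʳ (+ b))))) ⟩
    (+ a ℚᵘ./ 1) ℚᵘ.+ (+ b ℚᵘ./ 1)   ≃⟨ ℚᵘ.+-cong (toℚᵘ-/ (+ a) 1) (toℚᵘ-/ (+ b) 1) ⟨
    toℚᵘ (ι a) ℚᵘ.+ toℚᵘ (ι b)      ≃⟨ toℚᵘ-homo-+ (ι a) (ι b) ⟨
    toℚᵘ (ι a + ι b)               ∎)
    where open ℚᵘ.≤-Reasoning

  ι-* : ∀ a b → ι (a ℕ.* b) ≡ ι a * ι b
  ι-* a b = toℚᵘ-injective (begin-equality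
    toℚᵘ (ι (a ℕ.* b))             ≃⟨ toℚᵘ-/ (+ (a ℕ.* b)) 1 ⟩
    + (a ℕ.* b) ℚᵘ./ 1              ≡⟨ cong (ℚᵘ._/ 1) (ℤ.pos-* a b) ⟩
    (+ a ℚᵘ./ 1) ℚᵘ.* (+ b ℚᵘ./ 1)   ≃⟨ ℚᵘ.*-cong (toℚᵘ-/ (+ a) 1) (toℚᵘ-/ (+ b) 1) ⟨
    toℚᵘ (ι a) ℚᵘ.* toℚᵘ (ι b)      ≃⟨ toℚᵘ-homo-* (ι a) (ι b) ⟨
    toℚᵘ (ι a * ι b)               ∎)
    where open ℚᵘ.≤-Reasoning

  ι-mono : ∀ {a b} → a ℕ.≤ b → ι a ≤ ι b
  ι-mono {a} {b} h = toℚᵘ-cancel-≤ (begin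
    toℚᵘ (ι a)    ≃⟨ toℚᵘ-/ (+ a) 1 ⟩
    + a ℚᵘ./ 1    ≤⟨ ℚᵘ.*≤* (ℤ.*-monoʳ-≤-nonNeg (+ 1) (ℤ.+≤+ h)) ⟩
    + b ℚᵘ./ 1    ≃⟨ toℚᵘ-/ (+ b) 1 ⟨
    toℚᵘ (ι b)    ∎)
    where open ℚᵘ.≤-Reasoning

  ι-inverse : ∀ E .{{_ : ℕ.NonZero E}} → ι E * (+ 1 / E) ≡ 1ℚ
  ι-inverse E@(suc e) = toℚᵘ-injective (begin-equality
    toℚᵘ (ι E * (+ 1 / E))              ≃⟨ toℚᵘ-homo-* (ι E) (+ 1 / E) ⟩
    toℚᵘ (ι E) ℚᵘ.* toℚᵘ (+ 1 / E)      ≃⟨ ℚᵘ.*-cong (toℚᵘ-/ (+ E) 1) (toℚᵘ-/ (+ 1) E) ⟩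
    (+ E ℚᵘ./ 1) ℚᵘ.* (+ 1 ℚᵘ./ E)       ≃⟨ ℚᵘ.*≡* (cong +_ (trans (ℕ.*-identityʳ _)
      (trans (ℕ.*-identityʳ E) (sym (trans (ℕ.*-identityˡ _) (ℕ.*-identityˡ E)))))) ⟩
    ℚᵘ.1ℚᵘ                              ∎)
    where open ℚᵘ.≤-Reasoning

  1/-nonNegative : ∀ E .{{_ : ℕ.NonZero E}} → NonNegative (+ 1 / E)
  1/-nonNegative E@(suc e) = normalize-nonNeg 1 E

  open +-*-Solver

  -- The reciprocal is a variable `r` known only through E r = 1, so that both rearrangements are
  -- polynomial identities. `M` stands for m² and `K` for p².
  clear-denominators : ∀ (E w X M K r : ℚ) → E * r ≡ 1ℚ → NonNegative r →
    ι 8 * E * w + M ≤ ι 8 * E * X + K * M →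
    w ≤ X - (M * ((+ 1 / 8) - K * (+ 1 / 8))) * r
  clear-denominators E w X M K r inv r≥0 h = begin
    w                                       ≡⟨ unit w ⟨
    (E * r) * w                             ≡⟨ solve 4 (λ E w M r →
      (E :* r) :* w := (con (ι 8) :* E :* w :+ M) :* (r :* con ⅛) :- M :* (r :* con ⅛)) refl E w M r ⟩
    (ι 8 * E * w + M) * (r * ⅛) - M * (r * ⅛)
      ≤⟨ +-monoˡ-≤ (ℚ.- (M * (r * ⅛))) (*-monoʳ-≤-nonNeg (r * ⅛) {{nonNeg*nonNeg⇒nonNeg r {{r≥0}} ⅛}} h) ⟩
    (ι 8 * E * X + K * M) * (r * ⅛) - M * (r * ⅛)
      ≡⟨ solve 5 (λ E X M K r →
         (con (ι 8) :* E :* X :+ K :* M) :* (r :* con ⅛) :- M :* (r :* con ⅛) :=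
         (E :* r) :* X :- (M :* (con ⅛ :- K :* con ⅛)) :* r) refl E X M K r ⟩
    (E * r) * X - (M * (⅛ - K * ⅛)) * r     ≡⟨ cong (_- (M * (⅛ - K * ⅛)) * r) (unit X) ⟩
    X - (M * (⅛ - K * ⅛)) * r               ∎
    where
    open ≤-Reasoning
    ⅛ = + 1 / 8
    unit : ∀ x → (E * r) * x ≡ x
    unit x = trans (cong (_* x) inv) (*-identityˡ x)

  square-bound : ∀ p m s → 0ℚ ≤ p → ι s ≤ p * ι m → ι (s ℕ.* s) ≤ p * p * ι (m ℕ.* m)
  square-bound p m s p≥0 h = begin
    ι (s ℕ.* s)              ≡⟨ ι-* s s ⟩
    ι s * ι s                ≤⟨ *-monoʳ-≤-nonNeg (ι s) {{s≥0}} h ⟩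
    p * ι m * ι s            ≤⟨ *-monoˡ-≤-nonNeg (p * ι m) {{pm≥0}} h ⟩
    p * ι m * (p * ι m)      ≡⟨ solve 2 (λ p m → p :* m :* (p :* m) := p :* p :* (m :* m)) refl p (ι m) ⟩
    p * p * (ι m * ι m)      ≡⟨ cong (p * p *_) (ι-* m m) ⟨
    p * p * ι (m ℕ.* m)      ∎
    where
    open ≤-Reasoning
    s≥0 : NonNegative (ι s)
    s≥0 = normalize-nonNeg s 1
    pm≥0 : NonNegative (p * ι m)
    pm≥0 = nonNeg*nonNeg⇒nonNeg p {{ℚ.nonNegative p≥0}} (ι m) {{normalize-nonNeg m 1}}

  ι-linear : ∀ E x y → ι (8 ℕ.* E ℕ.* x ℕ.+ y) ≡ ι 8 * ι E * ι x + ι y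
  ι-linear E x y = trans (ι-+ (8 ℕ.* E ℕ.* x) y)
    (cong (_+ ι y) (trans (ι-* (8 ℕ.* E) x) (cong (_* ι x) (ι-* 8 E))))

  rational-bound : ∀ E w W m s .{{_ : ℕ.NonZero E}} (p : ℚ) → 0ℚ ≤ p → ι s ≤ p * ι m →
    8 ℕ.* E ℕ.* w ℕ.+ m ℕ.* m ℕ.≤ 8 ℕ.* E ℕ.* (W ℕ.+ m) ℕ.+ s ℕ.* s →
    ι w ≤ ι W + ι m - (ι (m ℕ.* m) * ((+ 1 / 8) - p * p * (+ 1 / 8))) * (+ 1 / E)
  rational-bound E w W m s p p≥0 s≤pm h =
    subst (λ x → ι w ≤ x - (ι (m ℕ.* m) * ((+ 1 / 8) - p * p * (+ 1 / 8))) * (+ 1 / E)) (ι-+ W m)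
      (clear-denominators (ι E) (ι w) (ι (W ℕ.+ m)) (ι (m ℕ.* m)) (p * p) (+ 1 / E) (ι-inverse E) (1/-nonNegative E) (begin
        ι 8 * ι E * ι w + ι (m ℕ.* m)            ≡⟨ ι-linear E w (m ℕ.* m) ⟨
        ι (8 ℕ.* E ℕ.* w ℕ.+ m ℕ.* m)            ≤⟨ ι-mono h ⟩
        ι (8 ℕ.* E ℕ.* (W ℕ.+ m) ℕ.+ s ℕ.* s)    ≡⟨ ι-linear E (W ℕ.+ m) (s ℕ.* s) ⟩
        ι 8 * ι E * ι (W ℕ.+ m) + ι (s ℕ.* s)    ≤⟨ +-monoʳ-≤ (ι 8 * ι E * ι (W ℕ.+ m)) (square-bound p m s p≥0 s≤pm) ⟩
        ι 8 * ι E * ι (W ℕ.+ m) + p * p * ι (m ℕ.* m) ∎))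
    where open ≤-Reasoning

open import Data.Nat using (ℕ; _*_; _^_)
import Data.Nat as ℕ
open import Data.Nat.Properties using (m^n≢0)
open import Data.Integer using (+_)
open import Data.Rational using (ℚ; _/_; 0ℚ; 1ℚ; _+_; _-_; _≤_)
import Data.Rational as ℚ
open import Data.List using (List; length)
open import Data.List.Relation.Unary.Unique.Propositional using (Unique)
open import Data.Fin.Subset using (Subset)
open import Relation.Nullary using (¬_)
open import Relation.Binary.PropositionalEquality using (_≡_; refl)
open import Data.Product using (_,_)
import Data.Nat.Properties as ℕ
import Data.Rational.Properties as ℚ

theorem34 : (n : ℕ) → 1 ℕ.≤ n →
            (ℬ : Family n) → Unique ℬ → SimplyRooted ℬ →
            (m : ℕ) → length ℬ ≡ m →
            (p : ℚ) → 0ℚ ≤ p → p ≤ 1ℚ →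
            (∀ i → ¬ (p ℚ.* (+ m / 1) ≤ (+ length (rootedFamily ℬ i) / 1))) →
            (𝓘 : List (List ℕ)) → IsColexInitial m 𝓘 →
            (+ weight ℬ / 1)
              ≤ (+ weightℕ 𝓘 / 1) + (+ m / 1)
                - ((+ (m * m) / 1) ℚ.* ((+ 1 / 8) - p ℚ.* p ℚ.* (+ 1 / 8)))
                  ℚ.* _/_ (+ 1) (2 ^ n) {{m^n≢0 2 n}}
theorem34 n 1≤n ℬ unique simplyRooted m refl p p≥0 _ few 𝓘 initial =
  let i , bound = RootedSets.weight-bound ℬ unique simplyRooted 1≤n in
  Denominators.rational-bound (2 ^ n) (weight ℬ) (weightℕ 𝓘) m (length (rootedFamily ℬ i))
    {{m^n≢0 2 n}} p p≥0
    (ℚ.<⇒≤ (ℚ.≰⇒> (few i)))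
    (ℕ.≤-trans bound (ℕ.+-monoˡ-≤ _ (ℕ.*-monoʳ-≤ (8 * 2 ^ n)
      (ℕ.+-monoˡ-≤ m (ColexInitialSegments.g≤weight initial)))))
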